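{- Let $T$ be a tree on $n$ vertices which is neither a path nor of the form $S^3(l_1,l_2,l_3)$. Then for every integer $k$ with $1\le k\le\kappa(T)$, \[\operatorname{wdim}_k(T)=\sum_{v\in R(T)} f_k(v),\] and moreover the set $S_k(T)=\bigcup_{v\in R(T)}S_k(v)$ is a weak $k$-resolving set of $T$ of minimum cardinality.
   Context: All graphs are finite, simple and connected; $d(u,v)$ is the distance. For vertices $x,y,s$ put $\Delta_s(x,y)=|d(x,s)-d(y,s)|$, $\Delta_S(x,y)=\sum_{s\in S}\Delta_s(x,y)$. For $k\ge1$, $S\subseteq V(G)$ is a weak $k$-resolving set if $\Delta_S(x,y)\ge k$ for all distinct $x,y\in V(G)$; $\operatorname{wdim}_k(G)$ is the minimum size of such a set, and $\kappa(G)$ is the largest $k$ for which one exists. In a tree $T$, for a vertex $v$ of degree $\ge3$, a thread of length $l$ hanging at $v$ is a path $vv_1\cdots v_l$ with $\deg(v_i)=2$ for $1\le i\le l-1$ and $\deg(v_l)=1$. A vertex of degree $\ge 3$ with at least two threads hanging at it is a root vertex; $R(T)$ is the set of root vertices; $\ell(v)$ is the number of threads hanging at $v$. For each root vertex $v$ label the threads hanging at $v$ as $P^{(j)}=vv^{(j)}_1\cdots v^{(j)}_{l_j(v)}$, $1\le j\le \ell(v)$, with $l_1(v)\le\cdots\le l_{\ell(v)}(v)$. $S^3(l_1,l_2,l_3)$ denotes a tree with exactly one root vertex, which has root degree 3 (a subdivision of $K_{1,3}$). Define $f_k(v)=\lceil k/4\rceil\ell(v)-1$ if $\lceil k/4\rceil\le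 l_1(v)$ and $k\equiv1,2\pmod 4$; $f_k(v)=\lceil k/4\rceil\ell(v)$ if $\lceil k/4\rceil\le l_1(v)$ and $k\equiv 3,0\pmod 4$; $f_k(v)=l_1(v)+(\ell(v)-1)(\lceil k/2\rceil-l_1(v))$ if $\lceil k/4\rceil>l_1(v)$. Define $S^{(1)}_k(v)=\{v^{(j)}_i:1\le i\le\lceil k/4\rceil,\ 1\le j\le\ell(v)\}$ and $S^{(2)}_k(v)=\{v^{(1)}_i:1\le i\le l_1(v)\}\cup\{v^{(j)}_i:1\le i\le\lceil k/2\rceil-l_1(v),\ 2\le j\le\ell(v)\}$, and let $S_k(v)=S^{(1)}_k(v)\setminus\{v^{(1)}_{\lceil k/4\rceil}\}$ if $\lceil k/4\rceil\le l_1(v)$ and $k\equiv1,2\pmod4$; $S_k(v)=S^{(1)}_k(v)$ if $\lceil k/4\rceil\le l_1(v)$ and $k\equiv3,0\pmod4$; $S_k(v)=S^{(2)}_k(v)$ if $\lceil k/4\rceil>l_1(v)$. -}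

module Defs where

open import Data.Bool using (Bool; true; false; if_then_else_; _∧_; _∨_; not)
open import Data.Nat using (ℕ; zero; suc; _+_; _*_; _∸_; _≤_; _<_; ∣_-_∣; _≤ᵇ_; _≡ᵇ_)
open import Data.Nat.DivMod using (_/_; _%_)
open import Data.Fin using (Fin; toℕ)
open import Data.Fin.Subset using (Subset; ⊥; ⁅_⁆; _∪_)
open import Data.Vec using (lookup)
open import Data.List using (List; []; _∷_; _++_; [_]; length; map; allFin; take; concat; foldr)
open import Data.Nat.ListAction using (sum)
open import Data.Bool.ListAction using (any)
open import Data.List.Relation.Unary.All using (All)
open import Data.List.Relation.Unary.Unique.Propositional using (Unique)
open import Data.List.Relation.Unary.Linked using (Linked)
open import Data.List.Membership.Propositional using (_∈_)
open import Data.Product using (Σ; ∃; _×_; _,_)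
open import Data.Unit using (⊤)
open import Relation.Nullary using (¬_; does)
open import Relation.Binary.PropositionalEquality using (_≡_; _≢_)
open import Function.Bundles using (_⇔_)
import Data.Fin as F

record Graph (n : ℕ) : Set where
  field
    adj    : Fin n → Fin n → Bool
    sym    : ∀ u v → adj u v ≡ adj v u
    irrefl : ∀ v → adj v v ≡ false
open Graph public

module _ {n : ℕ} (G : Graph n) where

  deg : Fin n → ℕ
  deg v = sum (map (λ w → if adj G v w then 1 else 0) (allFin n))

  within : ℕ → Fin n → Fin n → Bool
  within zero    u v = does (u F.≟ v)
  within (suc k) u v = within k u v ∨ any (λ w → within k u w ∧ adj G w v) (allFin n)

  Chain : List (Fin n) → Set
  Chain []           = ⊤
  Chain (x ∷ [])     = ⊤
  Chain (x ∷ y ∷ r)  = (adj G x y ≡ true) × Chain (y ∷ r)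

  Connected : Set
  Connected = ∀ u v → ∃ λ k → within k u v ≡ true

  HasCycle : Set
  HasCycle = Σ (Fin n) λ x → Σ (List (Fin n)) λ r →
    (2 ≤ length r) × Unique (x ∷ r) × Chain (x ∷ r ++ [ x ])

  IsTree : Set
  IsTree = Connected × ¬ HasCycle

  -- distance: least k (searched up to n) such that v is reachable from u
  -- in at most k steps (in a connected graph this is the usual distance)
  private
    search : Fin n → Fin n → ℕ → ℕ → ℕ
    search u v i zero    = i
    search u v i (suc f) = if within i u v then i else search u v (suc i) f

  dist : Fin n → Fin n → ℕ
  dist u v = search u v 0 n

  IsPathGraph : Set
  IsPathGraph = Σ (Fin n → Fin n) λ π →
    (∀ i j → π i ≡ π j → i ≡ j) ×
    (∀ i j → (adj G (π i) (π j) ≡ true) ⇔ ((suc (toℕ i) ≡ toℕ j) Data.Sum.⊎ (suc (toℕ j) ≡ toℕ i)))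
    where import Data.Sum

  -- G is a subdivision of K_{1,3}: exactly one vertex of degree ≥ 3, of degree 3
  IsS3 : Set
  IsS3 = Σ (Fin n) λ c → (deg c ≡ 3) × (∀ v → v ≢ c → deg v ≤ 2)

  ΔS : Subset n → Fin n → Fin n → ℕ
  ΔS S x y = sum (map (λ s → if lookup S s then ∣ dist x s - dist y s ∣ else 0) (allFin n))

  WeakResolving : ℕ → Subset n → Set
  WeakResolving k S = ∀ x y → x ≢ y → k ≤ ΔS S x y

  IsWdim : ℕ → ℕ → Set
  IsWdim k m = (Σ (Subset n) λ S → WeakResolving k S × Data.Fin.Subset.∣ S ∣ ≡ m)
             × (∀ S → WeakResolving k S → m ≤ Data.Fin.Subset.∣ S ∣)
    where import Data.Fin.Subset

  IsKappa : ℕ → Set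
  IsKappa κ = (Σ (Subset n) λ S → WeakResolving κ S)
            × (∀ k → Σ (Subset n) (λ S → WeakResolving k S) → k ≤ κ)

  IsThread : Fin n → List (Fin n) → Set
  IsThread v t = (3 ≤ deg v) × Unique (v ∷ t) × Chain (v ∷ t) ×
    Σ (List (Fin n)) λ ys → Σ (Fin n) λ z → (t ≡ ys ++ [ z ]) ×
      All (λ w → deg w ≡ 2) ys × (deg z ≡ 1)

  IsRoot : Fin n → Set
  IsRoot v = (3 ≤ deg v) × Σ (List (Fin n)) λ t₁ → Σ (List (Fin n)) λ t₂ →
    (t₁ ≢ t₂) × IsThread v t₁ × IsThread v t₂

  IsLabelling : Fin n → List (List (Fin n)) → Set
  IsLabelling v ts = All (IsThread v) ts × (∀ t → IsThread v t → t ∈ ts) ×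
    Unique ts × Linked (λ a b → length a ≤ length b) ts

-- f_k(v) and S_k(v), computed from a labelling ts of the threads at v

⌈_/4⌉ : ℕ → ℕ
⌈ k /4⌉ = (k + 3) / 4

⌈_/2⌉ : ℕ → ℕ
⌈ k /2⌉ = (k + 1) / 2

k≡1,2mod4 : ℕ → Bool
k≡1,2mod4 k = (k % 4 ≡ᵇ 1) ∨ (k % 4 ≡ᵇ 2)

fk : {A : Set} → ℕ → List (List A) → ℕ
fk k []          = 0
fk k ts@(P₁ ∷ _) =
  let c = ⌈ k /4⌉ ; ℓ = length ts ; l₁ = length P₁ in
  if c ≤ᵇ l₁
    then (if k≡1,2mod4 k then c * ℓ ∸ 1 else c * ℓ)
    else l₁ + (ℓ ∸ 1) * (⌈ k /2⌉ ∸ l₁)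

Sk : {A : Set} → ℕ → List (List A) → List A
Sk k []          = []
Sk k (P₁ ∷ rest) =
  let c = ⌈ k /4⌉ ; l₁ = length P₁ in
  if c ≤ᵇ l₁
    then (if k≡1,2mod4 k
            then take (c ∸ 1) P₁ ++ concat (map (take c) rest)
            else take c P₁ ++ concat (map (take c) rest))
    else P₁ ++ concat (map (take (⌈ k /2⌉ ∸ l₁)) rest)

toSubset : {n : ℕ} → List (Fin n) → Subset n
toSubset = foldr (λ x S → ⁅ x ⁆ ∪ S) ⊥

SkT : {n : ℕ} → ℕ → List (Fin n) → (Fin n → List (List (Fin n))) → Subset n
SkT k R lab = toSubset (concat (map (λ v → Sk k (lab v)) R))

ΣfkT : {n : ℕ} → ℕ → List (Fin n) → (Fin n → List (List (Fin n))) → ℕ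
ΣfkT k R lab = sum (map (λ v → fk k (lab v)) R)

{-# OPTIONS --safe #-}
-- Deleting a vertex w of the tree T leaves one component for each neighbour of w.  If such a
-- component contains a vertex of degree ≥ 3, then one farthest from w is a root with two threads
-- inside the component; if it contains none and deg w ≥ 3, the component is itself a thread at w.
-- Write m = ⌈k/2⌉.
--
-- Lower bound: the heads of two threads at v are equidistant from every vertex off these threads,
-- and their distances to any vertex differ by at most 2.  So a weak k-resolving set meets any two
-- threads at v in at least m vertices together, which forces at least f_k(v) vertices on the
-- threads at v; threads are pairwise disjoint.  With S = V(T) this also gives m ≤ l₁(v) + l₂(v).
--
-- S_k(T) resolves: it meets any two threads at a root in at least m vertices together.  If d(x,y)
-- is even, let w be the midpoint: every vertex in the component of x or of y in T − w contributes
-- at least 2, and these two components contain two threads of a common root, or else T is a path.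
-- If d(x,y) is odd, every vertex contributes at least 1, and |S_k(T)| ≥ 2m, since outside the
-- excluded shapes there are two disjoint pairs of threads, each at a common root.
module Submission where

open import Defs hiding (sym)
open import Data.Bool using (Bool; true; false; if_then_else_; T; T?; _∧_; _∨_)
open import Data.Bool.ListAction using (any)
import Data.Bool.Properties as Bool
open import Data.Bool.Properties using (T-≡; T-∧; ∨-zeroʳ)
open import Data.Empty using (⊥; ⊥-elim)
open import Data.Fin using (Fin; zero; suc; toℕ; fromℕ<)
import Data.Fin.Properties as Fin
open import Data.Fin.Subset using (Subset; ∣_∣; ⁅_⁆)
import Data.Fin.Subset as Subset
open import Data.Fin.Subset.Properties using (∉⊥; x∈⁅x⁆; x∈⁅y⁆⇒x≡y; x∈p∪q⁻; p⊆p∪q; q⊆p∪q)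
open import Data.List using (List; []; _∷_; _++_; [_]; length; map; concat; allFin; tabulate; filter; take)
open import Data.List.Extrema.Nat using (argmax; f[xs]≤f[argmax])
open import Data.List.Membership.Propositional using (_∈_; lose; find)
open import Data.List.Membership.Propositional.Properties
  using (∈-++⁺ˡ; ∈-++⁺ʳ; ∈-++⁻; ∈-∃++; ∈-allFin; ∈-filter⁺; ∈-filter⁻; ∈-concat⁺′; ∈-concat⁻′; ∈-map⁺)
open import Data.List.Properties
  using (length-++; length-map; length-take; take-all; map-++; map-tabulate; ∷-injectiveˡ)
open import Data.List.Relation.Unary.All using (All; []; _∷_)
import Data.List.Relation.Unary.All as All
import Data.List.Relation.Unary.All.Properties as All
open import Data.List.Relation.Unary.AllPairs using (AllPairs; []; _∷_)
import Data.List.Relation.Unary.AllPairs.Properties as AllPairs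
open import Data.List.Relation.Unary.Any using (Any; here; there)
import Data.List.Relation.Unary.Any as Any
open import Data.List.Relation.Unary.Any.Properties using (any⁺; any⁻)
open import Data.List.Relation.Unary.Linked.Properties using (Linked⇒AllPairs)
open import Data.List.Relation.Unary.Unique.Propositional using (Unique)
import Data.List.Relation.Unary.Unique.Propositional.Properties as Unique
open import Data.Nat
  using (ℕ; zero; suc; _+_; _*_; _≤_; _<_; z≤n; s≤s; ∣_-_∣; _∸_; _≤ᵇ_; _≡ᵇ_)
open import Data.Nat.Divisibility using (divides)
open import Data.Nat.DivMod
open import Data.Nat.ListAction using (sum)
open import Data.Nat.ListAction.Properties using (sum-++)
open import Data.Nat.Properties
open import Data.Product using (Σ; ∃; ∃₂; _×_; _,_; proj₁; proj₂)
open import Data.Sum using (_⊎_; inj₁; inj₂)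
open import Data.Vec using (lookup; []; _∷_)
open import Data.Vec.Properties using ([]=⇒lookup; lookup⇒[]=)
open import Function using (_∘_)
open import Function.Bundles using (_⇔_; mk⇔; Equivalence)
open import Relation.Binary.Definitions using (tri<; tri≈; tri>)
open import Relation.Binary.PropositionalEquality hiding ([_])
open import Relation.Nullary using (¬_; contradiction; yes; no; Dec)
open import Relation.Nullary.Decidable using (_×-dec_)
open import Algebra.Properties.CommutativeSemigroup +-commutativeSemigroup using (x∙yz≈y∙xz)

-- Sums over lists, cardinalities and degrees

private variable
  A : Set

-- Each y is matched with one occurrence in `xs`, which is then removed; `xs` itself may repeat.
-- Entries with f y = 0 are skipped, so only the support of f has to lie in `xs`: a sum over all
-- vertices can thus be bounded by one over two threads.
sum-map-⊆ : (f : A → ℕ) {ys xs : List A} → Unique ys →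
  (∀ {y} → y ∈ ys → 0 < f y → y ∈ xs) → sum (map f ys) ≤ sum (map f xs)
sum-map-⊆ f [] _ = z≤n
sum-map-⊆ f {y ∷ ys} {xs} (y∉ys ∷ uys) sub with f y in eq
... | zero = sum-map-⊆ f uys (sub ∘ there)
... | suc m with ∈-∃++ (sub (here refl) (subst (0 <_) (sym eq) (s≤s z≤n)))
...   | as , bs , refl = begin
  suc m + sum (map f ys)                          ≡⟨ cong (_+ sum (map f ys)) eq ⟨
  f y + sum (map f ys)                            ≤⟨ +-monoʳ-≤ (f y) (sum-map-⊆ f uys remaining) ⟩
  f y + sum (map f (as ++ bs))                    ≡⟨ cong (λ z → f y + sum z) (map-++ f as bs) ⟩
  f y + sum (map f as ++ map f bs)                ≡⟨ cong (f y +_) (sum-++ (map f as) _) ⟩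
  f y + (sum (map f as) + sum (map f bs))         ≡⟨ x∙yz≈y∙xz (f y) (sum (map f as)) _ ⟩
  sum (map f as) + (f y + sum (map f bs))         ≡⟨ sum-++ (map f as) _ ⟨
  sum (map f as ++ map f (y ∷ bs))                ≡⟨ cong sum (map-++ f as (y ∷ bs)) ⟨
  sum (map f (as ++ y ∷ bs))                      ∎
  where
  open ≤-Reasoning
  remaining : ∀ {z} → z ∈ ys → 0 < f z → z ∈ as ++ bs
  remaining z∈ys fz with ∈-++⁻ as (sub (there z∈ys) fz)
  ... | inj₁ z∈as = ∈-++⁺ˡ z∈as
  ... | inj₂ (here refl) = contradiction refl (All.lookup y∉ys z∈ys)
  ... | inj₂ (there z∈bs) = ∈-++⁺ʳ as z∈bs

sum-map-mono : {f g : A → ℕ} {xs : List A} → All (λ x → f x ≤ g x) xs →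
  sum (map f xs) ≤ sum (map g xs)
sum-map-mono [] = z≤n
sum-map-mono (p ∷ ps) = +-mono-≤ p (sum-map-mono ps)

sum-map-const : (c : ℕ) (xs : List A) → sum (map (λ _ → c) xs) ≡ length xs * c
sum-map-const c [] = refl
sum-map-const c (x ∷ xs) = cong (c +_) (sum-map-const c xs)

sum-map-* : (c : ℕ) (f : A → ℕ) (xs : List A) → sum (map (λ x → c * f x) xs) ≡ c * sum (map f xs)
sum-map-* c f [] = sym (*-zeroʳ c)
sum-map-* c f (x ∷ xs) = trans (cong (c * f x +_) (sum-map-* c f xs)) (sym (*-distribˡ-+ c (f x) _))

sum-map-++ : (f : A → ℕ) (xs ys : List A) → sum (map f (xs ++ ys)) ≡ sum (map f xs) + sum (map f ys)
sum-map-++ f xs ys = trans (cong sum (map-++ f xs ys)) (sum-++ (map f xs) (map f ys))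

sum-map-concat : (f : A → ℕ) (xss : List (List A)) →
  sum (map f (concat xss)) ≡ sum (map (sum ∘ map f) xss)
sum-map-concat f [] = refl
sum-map-concat f (xs ∷ xss) = trans (sum-map-++ f xs (concat xss)) (cong (_ +_) (sum-map-concat f xss))

indicator : ∀ {n} → Subset n → Fin n → ℕ
indicator S s = if lookup S s then 1 else 0

count : ∀ {n} → Subset n → List (Fin n) → ℕ
count S xs = sum (map (indicator S) xs)

indicator≤1 : ∀ {n} (S : Subset n) s → indicator S s ≤ 1
indicator≤1 S s with lookup S s
... | true = s≤s z≤n
... | false = z≤n

count≤length : ∀ {n} (S : Subset n) xs → count S xs ≤ length xs
count≤length S xs = subst (count S xs ≤_) (trans (sum-map-const 1 xs) (*-identityʳ _))
  (sum-map-mono (All.universal (indicator≤1 S) xs))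

card≡count : ∀ {n} (S : Subset n) → ∣ S ∣ ≡ count S (allFin n)
card≡count [] = refl
card≡count {suc n} (b ∷ S) = trans (step b) (cong (λ xs → indicator (b ∷ S) zero + sum xs) shift)
  where
  shift : map (indicator S) (allFin n) ≡ map (indicator (b ∷ S)) (tabulate suc)
  shift = trans (map-tabulate (λ i → i) (indicator S)) (sym (map-tabulate suc (indicator (b ∷ S))))
  step : ∀ b → ∣ b ∷ S ∣ ≡ (if b then 1 else 0) + count S (allFin n)
  step true = cong suc (card≡count S)
  step false = card≡count S

card-lower : ∀ {n} (S : Subset n) {xs} → Unique xs → count S xs ≤ ∣ S ∣
card-lower S {xs} uxs = subst (count S xs ≤_) (sym (card≡count S)) (sum-map-⊆ (indicator S) uxs λ _ _ → ∈-allFin _)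

card-upper : ∀ {n} (S : Subset n) {xs} → (∀ s → lookup S s ≡ true → s ∈ xs) → ∣ S ∣ ≤ length xs
card-upper {n} S {xs} sub = begin
  ∣ S ∣               ≡⟨ card≡count S ⟩
  count S (allFin n)  ≤⟨ sum-map-⊆ (indicator S) (Unique.allFin⁺ n) (λ {s} _ → elem s) ⟩
  count S xs          ≤⟨ count≤length S xs ⟩
  length xs           ∎
  where
  open ≤-Reasoning
  elem : ∀ s → 0 < indicator S s → s ∈ xs
  elem s p with lookup S s in eq
  elem s p | true = sub s eq

toSubset⁺ : ∀ {n} {xs : List (Fin n)} {s} → s ∈ xs → lookup (toSubset xs) s ≡ true
toSubset⁺ = []=⇒lookup ∘ go
  where
  go : ∀ {n} {xs : List (Fin n)} {s} → s ∈ xs → s Subset.∈ toSubset xs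
  go (here refl) = p⊆p∪q _ (x∈⁅x⁆ _)
  go (there s∈xs) = q⊆p∪q ⁅ _ ⁆ _ (go s∈xs)

toSubset⁻ : ∀ {n} (xs : List (Fin n)) s → lookup (toSubset xs) s ≡ true → s ∈ xs
toSubset⁻ xs s eq = go xs (lookup⇒[]= s _ eq)
  where
  go : ∀ {n} {s} (xs : List (Fin n)) → s Subset.∈ toSubset xs → s ∈ xs
  go [] p = contradiction p ∉⊥
  go (x ∷ xs) p with x∈p∪q⁻ ⁅ x ⁆ (toSubset xs) p
  ... | inj₁ q = here (x∈⁅y⁆⇒x≡y x q)
  ... | inj₂ q = there (go xs q)

module _ {n : ℕ} (G : Graph n) where

  -- Members of `S` outside `xs` can only add to the sum. The constant c will be 2 for x, y at even
  -- distance and 1 at odd distance.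
  ΔS-lower : (S : Subset n) (x y : Fin n) (c : ℕ) {xs : List (Fin n)} → Unique xs →
    All (λ s → lookup S s ≡ true) xs → All (λ s → c ≤ ∣ dist G x s - dist G y s ∣) xs →
    length xs * c ≤ ΔS G S x y
  ΔS-lower S x y c {xs} uxs inS far = begin
    length xs * c               ≡⟨ sum-map-const c xs ⟨
    sum (map (λ _ → c) xs)      ≤⟨ sum-map-mono (All.zipWith (λ {s} p → large (proj₁ p) (proj₂ p)) (inS , far)) ⟩
    sum (map f xs)              ≤⟨ sum-map-⊆ f uxs (λ _ _ → ∈-allFin _) ⟩
    ΔS G S x y                  ∎
    where
    open ≤-Reasoning
    f : Fin n → ℕ
    f s = if lookup S s then ∣ dist G x s - dist G y s ∣ else 0
    large : ∀ {s} → lookup S s ≡ true → c ≤ ∣ dist G x s - dist G y s ∣ → c ≤ f s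
    large eq p rewrite eq = p

  -- Vertices outside `xs` contribute 0. In the lower bound on cardinality, x and y are the heads of
  -- two threads, c is 2 and `xs` lists both threads.
  ΔS-upper : (S : Subset n) (x y : Fin n) (c : ℕ) (xs : List (Fin n)) →
    (∀ s → ∣ dist G x s - dist G y s ∣ ≤ c) →
    (∀ s → dist G x s ≢ dist G y s → s ∈ xs) →
    ΔS G S x y ≤ c * count S xs
  ΔS-upper S x y c xs small supp = begin
    ΔS G S x y                             ≤⟨ sum-map-⊆ f (Unique.allFin⁺ n) (λ {s} _ → member s) ⟩
    sum (map f xs)                         ≤⟨ sum-map-mono (All.universal bound xs) ⟩
    sum (map (λ s → c * indicator S s) xs) ≡⟨ sum-map-* c (indicator S) xs ⟩
    c * count S xs                         ∎
    where
    open ≤-Reasoning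
    f : Fin n → ℕ
    f s = if lookup S s then ∣ dist G x s - dist G y s ∣ else 0
    member : ∀ s → 0 < f s → s ∈ xs
    member s p with lookup S s
    ... | true = supp s λ eq → n≮n 0 (subst (0 <_) (m≡n⇒∣m-n∣≡0 eq) p)
    bound : ∀ s → f s ≤ c * indicator S s
    bound s with lookup S s
    ... | true = ≤-trans (small s) (≤-reflexive (sym (*-identityʳ c)))
    ... | false = z≤n

  neighbours : Fin n → List (Fin n)
  neighbours v = filter (T? ∘ adj G v) (allFin n)

  neighbours-adj : ∀ v {w} → w ∈ neighbours v → adj G v w ≡ true
  neighbours-adj v w∈ = Equivalence.to T-≡ (proj₂ (∈-filter⁻ (T? ∘ adj G v) {xs = allFin n} w∈))

  neighbours-unique : ∀ v → Unique (neighbours v)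
  neighbours-unique v = Unique.filter⁺ (T? ∘ adj G v) (Unique.allFin⁺ n)

  length-neighbours : ∀ v → length (neighbours v) ≡ deg G v
  length-neighbours v = go (allFin n)
    where
    go : ∀ xs → length (filter (T? ∘ adj G v) xs) ≡ sum (map (λ w → if adj G v w then 1 else 0) xs)
    go [] = refl
    go (w ∷ xs) with adj G v w
    ... | true = cong suc (go xs)
    ... | false = go xs

  deg-lower : ∀ v {xs} → Unique xs → All (λ w → adj G v w ≡ true) xs → length xs ≤ deg G v
  deg-lower v {xs} uxs adjs = begin
    length xs                     ≡⟨ trans (sum-map-const 1 xs) (*-identityʳ _) ⟨
    sum (map (λ _ → 1) xs)        ≤⟨ sum-map-⊆ (λ _ → 1) uxs (λ {y} y∈ _ → member y (All.lookup adjs y∈)) ⟩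
    sum (map (λ _ → 1) (neighbours v)) ≡⟨ trans (sum-map-const 1 (neighbours v)) (*-identityʳ _) ⟩
    length (neighbours v)         ≡⟨ length-neighbours v ⟩
    deg G v                       ∎
    where
    open ≤-Reasoning
    member : ∀ y → adj G v y ≡ true → y ∈ neighbours v
    member y eq = ∈-filter⁺ (T? ∘ adj G v) (∈-allFin y) (subst T (sym eq) _)

-- Distances

-- The search function of Defs is private; generalising one unfolding of dist over its arguments
-- lets unification recover it.
mutual
  search : ∀ {n} → Graph n → Fin n → Fin n → ℕ → ℕ → ℕ
  search = _

  dist-unfold : ∀ {m} (G : Graph (suc m)) u v →
    dist G u v ≡ (if within G 0 u v then 0 else search G u v 1 m)
  dist-unfold {m} G u v with suc m | G | u | v | 1
  ... | n | H | x | y | i = refl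

module Walks {n : ℕ} (G : Graph n) where

  infix 4 _~_
  _~_ : Fin n → Fin n → Set
  u ~ v = adj G u v ≡ true

  ~-sym : ∀ {u v} → u ~ v → v ~ u
  ~-sym {u} {v} = trans (Graph.sym G v u)

  ~⇒≢ : ∀ {u v} → u ~ v → u ≢ v
  ~⇒≢ {u} uv refl with trans (sym uv) (irrefl G u)
  ... | ()

  -- `wait` mirrors the first disjunct of `within`, so the index is an upper bound on the number of
  -- moves. In this inductive form walks can be composed and reversed.
  data Reach (u : Fin n) : ℕ → Fin n → Set where
    start : Reach u 0 u
    wait  : ∀ {k v} → Reach u k v → Reach u (suc k) v
    move    : ∀ {k w v} → Reach u k w → w ~ v → Reach u (suc k) v

  Reach⇒within : ∀ {u k v} → Reach u k v → within G k u v ≡ true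
  Reach⇒within {u} start with u Fin.≟ u
  ... | yes _ = refl
  ... | no u≢u = contradiction refl u≢u
  Reach⇒within {u} {suc k} {v} (wait r) =
    cong (_∨ any (λ w → within G k u w ∧ adj G w v) (allFin n)) (Reach⇒within r)
  Reach⇒within {u} {suc k} {v} (move {w = w} r wv) =
    trans (cong (within G k u v ∨_) (Equivalence.to T-≡ (any⁺ _ (lose (∈-allFin w) both)))) (∨-zeroʳ _)
    where
    both : T (within G k u w ∧ adj G w v)
    both = subst T (sym (cong₂ _∧_ (Reach⇒within r) wv)) _

  within⇒Reach : ∀ k {u v} → within G k u v ≡ true → Reach u k v
  within⇒Reach zero {u} {v} eq with u Fin.≟ v
  ... | yes refl = start
  within⇒Reach (suc k) {u} {v} eq with within G k u v in kv
  ... | true = wait (within⇒Reach k kv)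
  ... | false with find (any⁻ (λ w → within G k u w ∧ adj G w v) (allFin n) (subst T (sym eq) _))
  ...   | w , _ , both with Equivalence.to T-∧ both
  ...     | p , q = move (within⇒Reach k (Equivalence.to T-≡ p)) (Equivalence.to T-≡ q)

  Reach-trans : ∀ {u w v a b} → Reach u a w → Reach w b v → Reach u (b + a) v
  Reach-trans r start = r
  Reach-trans r (wait q) = wait (Reach-trans r q)
  Reach-trans r (move q wv) = move (Reach-trans r q) wv

  Reach-sym : ∀ {u k v} → Reach u k v → Reach v k u
  Reach-sym start = start
  Reach-sym (wait r) = wait (Reach-sym r)
  Reach-sym {u} {suc k} {v} (move r wv) = subst (λ j → Reach v j u) (+-comm k 1)
    (Reach-trans (move start (~-sym wv)) (Reach-sym r))

  record Least (u v : Fin n) (ℓ : ℕ) : Set where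
    constructor least
    field
      attained : Reach u ℓ v
      minimal  : ∀ j → Reach u j v → ℓ ≤ j
  open Least

  Least-unique : ∀ {u v k ℓ} → Least u v k → Least u v ℓ → k ≡ ℓ
  Least-unique p q = ≤-antisym (minimal p _ (attained q)) (minimal q _ (attained p))

  -- The bound k ≤ i + f lets the fuel reach a known walk length. When the fuel is used up, i = k,
  -- so the default result `i` is correct.
  search-least : ∀ {u v} f i k → i ≤ k → k ≤ i + f → Reach u k v →
    Reach u (search G u v i f) v × (∀ j → i ≤ j → Reach u j v → search G u v i f ≤ j)
  search-least zero i k i≤k k≤i kv with ≤-antisym i≤k (subst (k ≤_) (+-identityʳ i) k≤i)
  ... | refl = kv , λ j i≤j _ → i≤j
  search-least {u} {v} (suc f) i k i≤k k≤i kv with within G i u v in iv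
  ... | true = within⇒Reach i iv , λ j i≤j _ → i≤j
  ... | false =
    let found , low = search-least f (suc i) k (next i≤k kv) (subst (k ≤_) (+-suc i f) k≤i) kv
    in found , λ j i≤j jv → low j (next i≤j jv) jv
    where
    next : ∀ {j} → i ≤ j → Reach u j v → suc i ≤ j
    next {j} i≤j jv = ≤∧≢⇒< i≤j λ { refl → contradiction (trans (sym (Reach⇒within jv)) iv) λ () }

  Least-pred : ∀ {u v h} → Least u v (suc h) → ∃ λ w → w ~ v × Least u w h
  Least-pred (least (wait r) low) = contradiction (low _ r) (n≮n _)
  Least-pred (least (move r wv) low) = _ , wv , least r λ j q → ≤-pred (low (suc j) (move q wv))

  Least-levels : ∀ {u v} ℓ → Least u v ℓ → ∀ {j} → j ≤ ℓ → ∃ λ w → Least u w j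
  Least-levels zero l {zero} z≤n = _ , l
  Least-levels (suc ℓ) l {j} j≤ with Least-pred l
  ... | w , _ , l′ with j ≤? ℓ
  ...   | yes j≤ℓ = Least-levels ℓ l′ j≤ℓ
  ...   | no j≰ℓ with ≤-antisym j≤ (≰⇒> j≰ℓ)
  ...     | refl = _ , l

  -- A vertex at each distance 0, …, ℓ from u gives ℓ + 1 distinct vertices.
  Least-< : ∀ {u v ℓ} → Least u v ℓ → ℓ < n
  Least-< {u} {v} {ℓ} l = Fin.injective⇒≤ {f = λ i → proj₁ (level i)} inj
    where
    level : (i : Fin (suc ℓ)) → ∃ λ w → Least u w (toℕ i)
    level i = Least-levels ℓ l (≤-pred (Fin.toℕ<n i))
    inj : ∀ {i j} → proj₁ (level i) ≡ proj₁ (level j) → i ≡ j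
    inj {i} {j} eq = Fin.toℕ-injective
      (Least-unique (proj₂ (level i)) (subst (λ w → Least u w (toℕ j)) (sym eq) (proj₂ (level j))))

module Distance {n : ℕ} (G : Graph n) (connected : Connected G) where

  private
    V : Set
    V = Fin n
  open Walks G public

  dist-least : ∀ u v → Least u v (dist G u v)
  dist-least u v with connected u v
  -- A first search, with fuel K, finds the least walk length. By `Least-<` it is below n, which
  -- shows that the fuel n used by `dist` suffices.
  ... | K , Kv with search-least K 0 K z≤n ≤-refl (within⇒Reach K Kv)
  ...   | ℓv , ℓ-min with search-least n 0 _ z≤n (<⇒≤ (Least-< (least ℓv λ j → ℓ-min j z≤n))) ℓv
  ...     | found , low = least found λ j → low j z≤n

  -- Opaque, so that type checking never unfolds the search.
  opaque
    d : V → V → ℕ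
    d = dist G

    d≡dist : ∀ u v → d u v ≡ dist G u v
    d≡dist u v = refl

  private
    d-least : ∀ u v → Least u v (d u v)
    d-least u v = subst (Least u v) (sym (d≡dist u v)) (dist-least u v)

    reach : ∀ u v → Reach u (d u v) v
    reach u v = Least.attained (d-least u v)

    d≤ : ∀ {u v k} → Reach u k v → d u v ≤ k
    d≤ = Least.minimal (d-least _ _) _

  d<n : ∀ u v → d u v < n
  d<n u v = Least-< (d-least u v)

  d-refl : ∀ u → d u u ≡ 0
  d-refl u = n≤0⇒n≡0 (d≤ start)

  d-zero : ∀ {u v} → d u v ≡ 0 → u ≡ v
  d-zero {u} {v} eq with d u v | reach u v
  d-zero refl | _ | start = refl

  d-sym : ∀ u v → d u v ≡ d v u
  d-sym u v = ≤-antisym (d≤ (Reach-sym (reach v u))) (d≤ (Reach-sym (reach u v)))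

  d-triangle : ∀ u w v → d u v ≤ d u w + d w v
  d-triangle u w v = subst (d u v ≤_) (+-comm (d w v) (d u w)) (d≤ (Reach-trans (reach u w) (reach w v)))

  d-step : ∀ {v w} u → v ~ w → d u w ≤ suc (d u v)
  d-step {v} u vw = d≤ (move (reach u v) vw)

  d-stepˡ : ∀ {v w} u → v ~ w → d w u ≤ suc (d v u)
  d-stepˡ {v} {w} u vw = subst₂ (λ a b → a ≤ suc b) (d-sym u w) (d-sym u v) (d-step u vw)

  d-pred : ∀ {u v h} → d u v ≡ suc h → ∃ λ w → w ~ v × d u w ≡ h
  d-pred {u} {v} eq with Least-pred (subst (Least u v) eq (d-least u v))
  ... | w , wv , l = w , wv , Least-unique (d-least u w) l

  between : ∀ {x y} i j → d x y ≡ i + j → ∃ λ w → d x w ≡ i × d w y ≡ j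
  between {x} {y} i zero eq = y , trans eq (+-identityʳ i) , d-refl y
  between {x} {y} i (suc j) eq =
    let z , zy , xz = d-pred (trans eq (+-suc i j))
        w , xw , wz = between i j xz
        open ≤-Reasoning
        upper = begin
          d w y          ≤⟨ d-step w zy ⟩
          suc (d w z)    ≡⟨ cong suc wz ⟩
          suc j          ∎
        lower = begin
          i + suc j      ≡⟨ eq ⟨
          d x y          ≤⟨ d-triangle x w y ⟩
          d x w + d w y  ≡⟨ cong (_+ d w y) xw ⟩
          i + d w y      ∎
    in w , xw , ≤-antisym upper (+-cancelˡ-≤ i (suc j) (d w y) lower)

-- Trees as metric spaces

module Tree {n : ℕ} (G : Graph n) (tree : IsTree G) where

  open Distance G (proj₁ tree) public

  private
    V : Set
    V = Fin n

  Chain-snoc : ∀ xs {y z} → Chain G (xs ++ [ y ]) → y ~ z → Chain G ((xs ++ [ y ]) ++ [ z ])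
  Chain-snoc [] _ yz = yz , _
  Chain-snoc (x ∷ []) (xy , _) yz = xy , yz , _
  Chain-snoc (x ∷ x′ ∷ xs) (xx′ , c) yz = xx′ , Chain-snoc (x′ ∷ xs) c yz

  -- Following geodesics from a and b towards s until they meet.
  arc : ∀ s h {a b} → a ≢ b → d s a ≡ h → d s b ≡ h → ∃ λ r →
    1 ≤ length r × Unique r × Chain G (a ∷ r ++ [ b ]) × All (λ x → d s x < h) r
  arc-unique : ∀ s h {a b r} → a ≢ b → d s a ≡ h → d s b ≡ h → Unique r →
    All (λ x → d s x < h) r → Unique (a ∷ r ++ [ b ])

  arc s zero a≢b sa sb = contradiction (trans (sym (d-zero sa)) (d-zero sb)) a≢b
  arc s (suc h) {a} {b} a≢b sa sb =
    let p , pa , sp = d-pred sa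
        q , qb , sq = d-pred sb
    in join pa sp qb sq
    where
    join : ∀ {p q} → p ~ a → d s p ≡ h → q ~ b → d s q ≡ h → ∃ λ r →
      1 ≤ length r × Unique r × Chain G (a ∷ r ++ [ b ]) × All (λ x → d s x < suc h) r
    join {p} {q} pa sp qb sq with p Fin.≟ q
    ... | yes refl = [ p ] , s≤s z≤n , [] ∷ [] , (~-sym pa , qb , _) , ≤-reflexive (cong suc sp) ∷ []
    ... | no p≢q =
      let r , _ , ur , c , low = arc s h p≢q sp sq
      in p ∷ r ++ [ q ] , s≤s z≤n , arc-unique s h p≢q sp sq ur low ,
         (~-sym pa , Chain-snoc (p ∷ r) c qb) ,
         ≤-reflexive (cong suc sp) ∷ All.++⁺ (All.map m<n⇒m<1+n low) (≤-reflexive (cong suc sq) ∷ [])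

  arc-unique s h {a} {b} {r} a≢b sa sb ur low =
    All.++⁺ (All.map (λ { x<h refl → n≮n h (subst (_< h) sa x<h) }) low) (a≢b ∷ []) ∷
    Unique.++⁺ ur ([] ∷ []) λ { (x∈r , here refl) → n≮n h (subst (_< h) sb (All.lookup low x∈r)) }

  -- Otherwise an arc from x to y through vertices nearer to s would close up with the edge xy to a
  -- cycle.
  ~⇒d≢ : ∀ s {x y} → x ~ y → d s x ≢ d s y
  ~⇒d≢ s {x} {y} xy eq =
    let r , 1≤r , ur , c , low = arc s (d s y) (~⇒≢ xy) eq refl
    in proj₂ tree (x , r ++ [ y ] ,
         subst (2 ≤_) (sym (trans (length-++ r) (+-comm (length r) 1))) (s≤s 1≤r) ,
         arc-unique s (d s y) (~⇒≢ xy) eq refl ur low , Chain-snoc (x ∷ r) c (~-sym xy))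

  -- Otherwise an arc from a to b, all of it within distance h of s, would close up to a cycle
  -- through y, which is at distance h + 1.
  parent-unique : ∀ s {h a b y} → a ~ y → b ~ y → d s a ≡ h → d s b ≡ h → d s y ≡ suc h → a ≡ b
  parent-unique s {h} {a} {b} {y} ay by sa sb sy with a Fin.≟ b
  ... | yes a≡b = a≡b
  ... | no a≢b =
    let r , 1≤r , ur , c , low = arc s h a≢b sa sb
        above : ∀ {x} → d s x ≤ h → y ≢ x
        above = λ { x≤h refl → n≮n h (subst (_≤ h) sy x≤h) }
    in contradiction
         (y , a ∷ r ++ [ b ] , s≤s (subst (1 ≤_) (sym (trans (length-++ r) (+-comm (length r) 1))) (s≤s z≤n)) ,
          (above (≤-reflexive sa) ∷ All.++⁺ (All.map (above ∘ <⇒≤) low) (above (≤-reflexive sb) ∷ [])) ∷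
            arc-unique s h a≢b sa sb ur low ,
          (~-sym ay , Chain-snoc (a ∷ r) c by))
         (proj₂ tree)

  ~⇒±1 : ∀ s {x y} → x ~ y → d s x ≡ suc (d s y) ⊎ d s y ≡ suc (d s x)
  ~⇒±1 s {x} {y} xy with <-cmp (d s x) (d s y)
  ... | tri< lt _ _ = inj₂ (≤-antisym (d-step s xy) lt)
  ... | tri> _ _ gt = inj₁ (≤-antisym (d-step s (~-sym xy)) gt)
  ... | tri≈ _ eq _ = contradiction eq (~⇒d≢ s xy)

  -- For adjacent w and u: s lies in the component of u after deletion of w.
  Beyond : V → V → V → Set
  Beyond w u s = d s w ≡ suc (d s u)

  beyond-asym : ∀ {w u s} → Beyond w u s → ¬ Beyond u w s
  beyond-asym p q = m≢1+n+m _ (trans p (cong suc q))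

  ~⇒d≡1 : ∀ {u v} → u ~ v → d u v ≡ 1
  ~⇒d≡1 {u} uv with ~⇒±1 u uv
  ... | inj₁ p = contradiction (trans (sym (d-refl u)) p) λ ()
  ... | inj₂ p = trans p (cong suc (d-refl u))

  beyond-self : ∀ {w u} → w ~ u → Beyond w u u
  beyond-self {w} {u} wu = trans (~⇒d≡1 (~-sym wu)) (cong suc (sym (d-refl u)))

  toward : ∀ {w s} → w ≢ s → ∃ λ u → w ~ u × Beyond w u s
  toward {w} {s} w≢s with d s w in eq
  ... | zero = contradiction (sym (d-zero eq)) w≢s
  ... | suc h = let u , uw , su = d-pred eq in u , ~-sym uw , cong suc (sym su)

  beyond-unique : ∀ {w u u′ s} → w ~ u → w ~ u′ → Beyond w u s → Beyond w u′ s → u ≡ u′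
  beyond-unique {s = s} wu wu′ p q =
    parent-unique s (~-sym wu) (~-sym wu′) refl (suc-injective (trans (sym q) p)) p

  -- The edge wu is the only one between its two sides. If p were not u, then q would have two
  -- parents as seen from u: p, and the neighbour of q nearer to w. They must coincide, but their
  -- distances from w differ by 2.
  crossing : ∀ {w u p q} → w ~ u → p ~ q → Beyond w u p → Beyond u w q → p ≡ u × q ≡ w
  crossing {w} {u} {p} {q} wu pq wp uq = cross (d p u) refl
    where
    wp′ : d w p ≡ suc (d p u)
    wp′ = trans (d-sym w p) wp
    uq′ : d u q ≡ suc (d q w)
    uq′ = trans (d-sym u q) uq
    same : d q w ≡ d p u
    same with ~⇒±1 w pq | ~⇒±1 u pq
    ... | inj₁ e | _ = suc-injective (trans (cong suc (d-sym q w)) (trans (sym e) wp′))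
    ... | inj₂ _ | inj₂ e = suc-injective (trans (sym uq′) (trans e (cong suc (d-sym u p))))
    -- This combination would give d p u = 4 + d p u.
    ... | inj₂ e | inj₁ e′ = contradiction
      (trans (d-sym p u) (trans e′ (cong suc (trans uq′ (cong suc (trans (d-sym q w) (trans e (cong suc wp′))))))))
      (m≢1+n+m (d p u) {3})
    cross : ∀ h → d p u ≡ h → p ≡ u × q ≡ w
    cross zero pu = d-zero pu , d-zero (trans same pu)
    cross (suc h) pu =
      let z , zq , wz = d-pred (trans (d-sym w q) (trans same pu))
          uq″ = trans uq′ (cong suc (trans same pu))
          uz = ≤-antisym (subst (d u z ≤_) (cong suc wz) (d-stepˡ z wu))
                         (≤-pred (subst (_≤ suc (d u z)) uq″ (d-step u zq)))
          z≡p = parent-unique u zq pq uz (trans (d-sym u p) pu) uq″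
      in contradiction (trans (sym wz) (trans (cong (d w) z≡p) (trans wp′ (cong suc pu)))) (m≢1+n+m h {1})

  -- A geodesic from s to y has to use the edge uw and so passes through w. The induction strips off
  -- the last vertex y: either its predecessor is still on the side of w, or `crossing` identifies y
  -- with w.
  separation : ∀ {w u y s} → w ~ u → Beyond w u s → Beyond u w y → d s y ≡ d s w + d w y
  separation {w} {u} {y} {s} wu ws uy = go (d s y) refl uy
    where
    go : ∀ h {y} → d s y ≡ h → Beyond u w y → d s y ≡ d s w + d w y
    go zero sy uy with d-zero sy
    ... | refl = contradiction uy (beyond-asym ws)
    go (suc h) {y} sy uy = let q , qy , sq = d-pred sy in step q qy sq (~⇒±1 q wu)
      where
      open ≤-Reasoning
      step : ∀ q → q ~ y → d s q ≡ h → Beyond w u q ⊎ Beyond u w q → d s y ≡ d s w + d w y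
      step q qy sq (inj₁ wq) with crossing wu qy wq uy
      ... | _ , refl = sym (trans (cong (d s w +_) (d-refl w)) (+-identityʳ _))
      step q qy sq (inj₂ uq) = ≤-antisym (d-triangle s w y) (begin
        d s w + d w y        ≤⟨ +-monoʳ-≤ (d s w) (d-step w qy) ⟩
        d s w + suc (d w q)  ≡⟨ +-suc (d s w) (d w q) ⟩
        suc (d s w + d w q)  ≡⟨ cong suc (go h sq uq) ⟨
        suc (d s q)          ≡⟨ cong suc sq ⟩
        suc h                ≡⟨ sy ⟨
        d s y                ∎)

  -- From s, y is reached only through the edge ab, so d y s = d b y + 1 + d a s, whereas d x s ≤ d
  -- a x + d a s. With b the midpoint of x and y this is used for c = 2, with ab the middle edge for
  -- c = 1.
  far-apart : ∀ {a b x y s} c → a ~ b → Beyond a b y → Beyond b a s → c + d a x ≤ suc (d b y) →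
    c ≤ ∣ d x s - d y s ∣
  far-apart {a} {b} {x} {y} {s} c ab ay bs le = begin
    c                          ≤⟨ m+n≤o⇒m≤o∸n c bound ⟩
    d y s ∸ d x s              ≤⟨ m∸n≤∣m-n∣ (d y s) (d x s) ⟩
    ∣ d y s - d x s ∣          ≡⟨ ∣-∣-comm (d y s) (d x s) ⟩
    ∣ d x s - d y s ∣          ∎
    where
    open ≤-Reasoning
    bound : c + d x s ≤ d y s
    bound = begin
      c + d x s               ≤⟨ +-monoʳ-≤ c (d-triangle x a s) ⟩
      c + (d x a + d a s)     ≡⟨ +-assoc c (d x a) (d a s) ⟨
      c + d x a + d a s       ≡⟨ cong₂ (λ i j → c + i + j) (d-sym x a) (d-sym a s) ⟩
      c + d a x + d s a       ≤⟨ +-monoˡ-≤ (d s a) le ⟩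
      suc (d b y) + d s a     ≡⟨ +-comm (suc (d b y)) (d s a) ⟩
      d s a + suc (d b y)     ≡⟨ +-suc (d s a) (d b y) ⟩
      suc (d s a) + d b y     ≡⟨ cong (_+ d b y) bs ⟨
      d s b + d b y           ≡⟨ separation (~-sym ab) bs ay ⟨
      d s y                   ≡⟨ d-sym s y ⟩
      d y s                   ∎

  -- The edge ww′ lies on a geodesic from x to y, so it separates them: with either end on the wrong
  -- side there would be a shorter route.
  geodesic-edge : ∀ {x y w w′} → w ~ w′ → d x y ≡ d x w + suc (d w′ y) → Beyond w w′ y × Beyond w′ w x
  geodesic-edge {x} {y} {w} {w′} ww′ eq = left (~⇒±1 y ww′) , right (~⇒±1 x ww′)
    where
    open ≤-Reasoning
    left : Beyond w w′ y ⊎ Beyond w′ w y → Beyond w w′ y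
    left (inj₁ p) = p
    left (inj₂ p) = contradiction (begin-strict
      d x y                        ≤⟨ d-triangle x w y ⟩
      d x w + d w y                ≡⟨ cong (d x w +_) (d-sym w y) ⟩
      d x w + d y w                <⟨ +-monoʳ-< (d x w) (m<n⇒m<1+n ≤-refl) ⟩
      d x w + suc (suc (d y w))    ≡⟨ cong (λ m → d x w + suc m) (trans (sym p) (d-sym y w′)) ⟩
      d x w + suc (d w′ y)         ≡⟨ eq ⟨
      d x y                        ∎) (n≮n _)
    right : Beyond w w′ x ⊎ Beyond w′ w x → Beyond w′ w x
    right (inj₂ p) = p
    right (inj₁ p) = contradiction (begin-strict
      d x y                        ≤⟨ d-triangle x w′ y ⟩
      d x w′ + d w′ y              <⟨ +-mono-≤-< (m≤n⇒m≤1+n ≤-refl) (n<1+n _) ⟩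
      suc (d x w′) + suc (d w′ y)  ≡⟨ cong (_+ suc (d w′ y)) p ⟨
      d x w + suc (d w′ y)         ≡⟨ eq ⟨
      d x y                        ∎) (n≮n _)

-- Threads and paths

module Threads {n : ℕ} (G : Graph n) (tree : IsTree G) where

  open Tree G tree public

  private
    V : Set
    V = Fin n

  -- Handing the list over as a variable, together with its properties, lets callers match on its
  -- shape; a direct match would be stuck on `filter`.
  neighbours-rec : ∀ v (P : List V → Set) →
    (∀ ns → Unique ns → All (v ~_) ns → length ns ≡ deg G v → P ns) → P (neighbours G v)
  neighbours-rec v P f = f _ (neighbours-unique G v) (All.tabulate (neighbours-adj G v)) (length-neighbours G v)

  third-neighbour : ∀ {p a b c} → deg G p ≤ 2 → p ~ a → p ~ b → p ~ c → a ≢ b → c ≡ a ⊎ c ≡ b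
  third-neighbour {p} {a} {b} {c} deg≤2 pa pb pc a≢b with c Fin.≟ a | c Fin.≟ b
  ... | yes c≡a | _ = inj₁ c≡a
  ... | no _ | yes c≡b = inj₂ c≡b
  ... | no c≢a | no c≢b = contradiction
    (≤-trans (deg-lower G p ((c≢a ∷ c≢b ∷ []) ∷ (a≢b ∷ []) ∷ [] ∷ []) (pc ∷ pa ∷ pb ∷ [])) deg≤2) (n≮n 2)

  second-neighbour : ∀ {p a b} → deg G p ≤ 1 → p ~ a → p ~ b → a ≡ b
  second-neighbour {p} {a} {b} deg≤1 pa pb with a Fin.≟ b
  ... | yes a≡b = a≡b
  ... | no a≢b = contradiction (≤-trans (deg-lower G p ((a≢b ∷ []) ∷ [] ∷ []) (pa ∷ pb ∷ [])) deg≤1) (n≮n 1)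

  other-neighbour : ∀ {p q} → deg G p ≤ 2 → q ~ p →
    deg G p ≡ 1 ⊎ (deg G p ≡ 2 × ∃ λ p′ → p ~ p′ × q ≢ p′)
  other-neighbour {p} {q} deg≤2 qp = neighbours-rec p _ pick
    where
    pick : ∀ ns → Unique ns → All (p ~_) ns → length ns ≡ deg G p →
      deg G p ≡ 1 ⊎ (deg G p ≡ 2 × ∃ λ p′ → p ~ p′ × q ≢ p′)
    pick [] _ _ eq = contradiction
      (subst (1 ≤_) (sym eq) (deg-lower G p ([] ∷ []) (~-sym qp ∷ []))) (n≮n 0)
    pick (a ∷ []) _ _ eq = inj₁ (sym eq)
    pick (a ∷ b ∷ []) ((a≢b ∷ _) ∷ _) (pa ∷ pb ∷ _) eq with q Fin.≟ a
    ... | yes refl = inj₂ (sym eq , b , pb , a≢b)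
    ... | no q≢a = inj₂ (sym eq , a , pa , q≢a)
    pick (_ ∷ _ ∷ _ ∷ _) _ _ eq =
      contradiction (≤-trans (s≤s (s≤s (s≤s z≤n))) (subst (_≤ 2) (sym eq) deg≤2)) (n≮n 2)

  -- By uniqueness of parents at most one of three neighbours of b is nearer to s, so two of them
  -- lead away from s.
  two-children : ∀ s {b} → 3 ≤ deg G b → ∃₂ λ c c′ → c ≢ c′ × (b ~ c × Beyond c b s) × (b ~ c′ × Beyond c′ b s)
  two-children s {b} deg≥3 = neighbours-rec b _ pick
    where
    parent : V → Set
    parent c = d s b ≡ suc (d s c)
    one-parent : ∀ {a c} → b ~ a → b ~ c → a ≢ c → parent a → Beyond c b s
    one-parent {a} {c} ba bc a≢c pa with ~⇒±1 s bc
    ... | inj₂ up = up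
    ... | inj₁ pc = contradiction (beyond-unique ba bc pa pc) a≢c
    pick : ∀ ns → Unique ns → All (b ~_) ns → length ns ≡ deg G b →
      ∃₂ λ c c′ → c ≢ c′ × (b ~ c × Beyond c b s) × (b ~ c′ × Beyond c′ b s)
    pick (x ∷ y ∷ z ∷ _) ((x≢y ∷ x≢z ∷ _) ∷ (y≢z ∷ _) ∷ _) (bx ∷ by ∷ bz ∷ _) _
      with ~⇒±1 s bx | ~⇒±1 s by
    ... | inj₁ px | _ = y , z , y≢z , (by , one-parent bx by x≢y px) , (bz , one-parent bx bz x≢z px)
    ... | inj₂ ux | inj₁ py = x , z , x≢z , (bx , ux) , (bz , one-parent by bz y≢z py)
    ... | inj₂ ux | inj₂ uy = x , y , x≢y , (bx , ux) , (by , uy)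
    pick [] _ _ eq = contradiction (subst (3 ≤_) (sym eq) deg≥3) λ ()
    pick (_ ∷ []) _ _ eq = contradiction (subst (3 ≤_) (sym eq) deg≥3) λ { (s≤s ()) }
    pick (_ ∷ _ ∷ []) _ _ eq = contradiction (subst (3 ≤_) (sym eq) deg≥3) λ { (s≤s (s≤s ())) }

  -- The geodesic from s to w passes through b, and from b it reaches u before w.
  beyond-trans : ∀ {w u b c s} → w ~ u → b ~ c → Beyond w u b → Beyond c b w → Beyond b c s → Beyond w u s
  beyond-trans {w} {u} {b} {c} {s} wu bc wb cw bs with ~⇒±1 s wu
  ... | inj₁ p = p
  ... | inj₂ p = contradiction (begin-strict
    d s w                <⟨ n<1+n _ ⟩
    suc (d s w)          ≡⟨ p ⟨
    d s u                ≤⟨ d-triangle s b u ⟩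
    d s b + d b u        <⟨ +-monoʳ-< (d s b) (n<1+n _) ⟩
    d s b + suc (d b u)  ≡⟨ cong (d s b +_) wb ⟨
    d s b + d b w        ≡⟨ separation bc bs cw ⟨
    d s w                ∎) (n≮n _)
    where open ≤-Reasoning

  -- A thread without the degree condition at its root, in a form suited to induction from the head.
  -- Simplicity is replaced by the local condition `q ≢ p′` against turning back; in a tree this is
  -- enough.
  data Leg : V → List V → Set where
    end  : ∀ {q p} → q ~ p → deg G p ≡ 1 → Leg q [ p ]
    next : ∀ {q p p′ t} → q ~ p → deg G p ≡ 2 → q ≢ p′ → Leg p (p′ ∷ t) → Leg q (p ∷ p′ ∷ t)

  leg-head : ∀ {q p t} → Leg q (p ∷ t) → q ~ p
  leg-head (end qp _) = qp
  leg-head (next qp _ _ _) = qp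

  thread⇒leg : ∀ {v t} → IsThread G v t → Leg v t
  thread⇒leg {v} (_ , uvt , cvt , ys , z , refl , deg2 , deg1) = build v ys uvt cvt deg2
    where
    build : ∀ q ys → Unique (q ∷ ys ++ [ z ]) → Chain G (q ∷ ys ++ [ z ]) →
      All (λ w → deg G w ≡ 2) ys → Leg q (ys ++ [ z ])
    build q [] u c _ = end (proj₁ c) deg1
    build q (y ∷ []) ((_ ∷ q≢z ∷ _) ∷ u) (qy , c) (e ∷ es) = next qy e q≢z (build y [] u c es)
    build q (y ∷ y′ ∷ ys) ((_ ∷ q≢y′ ∷ _) ∷ u) (qy , c) (e ∷ es) = next qy e q≢y′ (build y (y′ ∷ ys) u c es)

  leg-child : ∀ v {q p p′} → q ~ p → p ~ p′ → q ≢ p′ → Beyond p q v → Beyond p′ p v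
  leg-child v {q} {p} {p′} qp pp′ q≢p′ up with ~⇒±1 v pp′
  ... | inj₂ up′ = up′
  ... | inj₁ down = contradiction (beyond-unique (~-sym qp) pp′ up down) q≢p′

  -- Each vertex has only one neighbour nearer to v, and the leg does not turn back, so distances
  -- from v strictly increase along it. This recovers the distinctness that `Leg` does not record.
  leg-rising : ∀ v {q p t} → Leg q (p ∷ t) → Beyond p q v → All (λ x → d v q < d v x) (p ∷ t) × Unique (p ∷ t)
  leg-rising v (end qp _) up = ≤-reflexive (sym up) ∷ [] , [] ∷ []
  leg-rising v {q} {p} (next qp _ q≢p′ leg) up =
    let low , u = leg-rising v leg (leg-child v qp (leg-head leg) q≢p′ up)
    in ≤-reflexive (sym up) ∷ All.map (<-trans (≤-reflexive (sym up))) low ,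
       All.map (λ { lt refl → n≮n _ lt }) low ∷ u

  leg-beyond : ∀ {v u q p t} → v ~ u → Leg q (p ∷ t) → Beyond p q v → Beyond v u p → All (Beyond v u) (p ∷ t)
  leg-beyond vu (end _ _) _ b = b ∷ []
  leg-beyond {v} vu (next qp _ q≢p′ leg) up b =
    b ∷ leg-beyond vu leg up′ (beyond-trans vu pp′ b up′ (beyond-self pp′))
    where
    pp′ = leg-head leg
    up′ = leg-child v qp pp′ q≢p′ up

  leg-low-degree : ∀ {q t} → Leg q t → All (λ x → deg G x ≤ 2) t
  leg-low-degree (end _ e) = ≤-trans (≤-reflexive e) (s≤s z≤n) ∷ []
  leg-low-degree (next _ e _ leg) = ≤-reflexive e ∷ leg-low-degree leg

  leg-closed : ∀ {q t x y} → Leg q t → x ∈ t → x ~ y → y ∈ q ∷ t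
  leg-closed (end qp e) (here refl) xy = here (second-neighbour (≤-reflexive e) xy (~-sym qp))
  leg-closed (next qp e q≢p′ leg) (here refl) xy
    with third-neighbour (≤-reflexive e) (~-sym qp) (leg-head leg) xy q≢p′
  ... | inj₁ y≡q = here y≡q
  ... | inj₂ y≡p′ = there (there (here y≡p′))
  leg-closed (next _ _ _ leg) (there x∈t) xy = there (leg-closed leg x∈t xy)

  -- A vertex of degree 2 leaves a single way onwards and a leaf leaves none, so the head determines
  -- the rest.
  leg-unique : ∀ {q p t t′} → Leg q (p ∷ t) → Leg q (p ∷ t′) → t ≡ t′
  leg-unique (end _ _) (end _ _) = refl
  leg-unique (end _ e) (next _ e′ _ _) = contradiction (trans (sym e) e′) λ ()
  leg-unique (next _ e _ _) (end _ e′) = contradiction (trans (sym e) e′) λ ()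
  leg-unique (next qp e q≢ leg) (next _ _ q≢′ leg′)
    with third-neighbour (≤-reflexive e) (~-sym qp) (leg-head leg) (leg-head leg′) q≢
  ... | inj₁ eq = contradiction (sym eq) q≢′
  ... | inj₂ refl = cong (_ ∷_) (leg-unique leg leg′)

  -- A leg is closed under adjacency except at v. Induction on the distance from v: the predecessor
  -- of s is on the leg already, or it lies on the side of v and `crossing` gives s = u.
  leg-covers : ∀ {v u t} → Leg v (u ∷ t) → ∀ {s} → Beyond v u s → s ∈ u ∷ t
  leg-covers {v} {u} {t} leg {s} = go (d v s) refl
    where
    vu = leg-head leg
    go : ∀ h {s} → d v s ≡ h → Beyond v u s → s ∈ u ∷ t
    go zero {s} vs b = contradiction (trans (sym b) (trans (d-sym s v) vs)) λ ()
    go (suc h) {s} vs b = let q , qs , vq = d-pred vs in step q qs vq (~⇒±1 q vu)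
      where
      step : ∀ q → q ~ s → d v q ≡ h → Beyond v u q ⊎ Beyond u v q → s ∈ u ∷ t
      step q qs vq (inj₂ b′) = here (proj₁ (crossing vu (~-sym qs) b b′))
      step q qs vq (inj₁ b′) with leg-closed leg (go h vq b′) qs
      ... | here refl = contradiction (trans (sym b) (d-refl v)) λ ()
      ... | there s∈ = s∈

  leg⇒thread : ∀ {v u t} → 3 ≤ deg G v → Leg v (u ∷ t) → IsThread G v (u ∷ t)
  leg⇒thread {v} {u} {t} deg≥3 leg =
    let low , unique = leg-rising v leg (beyond-self (~-sym (leg-head leg)))
        c , rest = shape leg
    in deg≥3 , All.map (λ { lt refl → n≮n _ lt }) low ∷ unique , c , rest
    where
    shape : ∀ {q t} → Leg q t → Chain G (q ∷ t) ×
      Σ (List V) λ ys → Σ V λ z → (t ≡ ys ++ [ z ]) × All (λ w → deg G w ≡ 2) ys × (deg G z ≡ 1)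
    shape (end qp e) = (qp , _) , [] , _ , refl , [] , e
    shape (next qp e _ leg) = let c , ys , z , eq , all2 , e′ = shape leg in
      (qp , c) , _ ∷ ys , z , cong (_ ∷_) eq , e ∷ all2 , e′

  record ThreadView (v : V) (t : List V) : Set where
    constructor view
    field
      {head} : V
      {rest} : List V
      shape  : t ≡ head ∷ rest
      leg    : Leg v (head ∷ rest)
      inside : All (Beyond v head) (head ∷ rest)

  thread-view : ∀ {v t} → IsThread G v t → ThreadView v t
  thread-view th with thread⇒leg th
  ... | leg@(end vp _) = view refl leg (leg-beyond vp leg (beyond-self (~-sym vp)) (beyond-self vp))
  ... | leg@(next vp _ _ _) = view refl leg (leg-beyond vp leg (beyond-self (~-sym vp)) (beyond-self vp))

  -- For a common root, x determines the head and the head determines the thread. For different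
  -- roots, each root has degree at least 3 and so lies off the other's thread; then from x, v comes
  -- before v′ and v′ before v, which forces d v v′ = 0.
  threads-disjoint : ∀ {v v′ t t′ x} → IsThread G v t → IsThread G v′ t′ → x ∈ t → x ∈ t′ → v ≡ v′ × t ≡ t′
  threads-disjoint {v} {v′} {x = x} th th′ x∈ x∈′
    with thread-view th | thread-view th′ | v Fin.≟ v′
  ... | view {u} refl leg inside | view {u′} refl leg′ inside′ | yes refl
    with beyond-unique (leg-head leg) (leg-head leg′) (All.lookup inside x∈) (All.lookup inside′ x∈′)
  ...   | refl = refl , cong (u ∷_) (leg-unique leg leg′)
  threads-disjoint {v} {v′} {x = x} th th′ x∈ x∈′
      | view {u} refl leg inside | view {u′} refl leg′ inside′ | no v≢v′ =
    contradiction (d-zero (m+n≡0⇒n≡0 (d v′ v) (+-cancelˡ-≡ (d x v) _ _ loop))) v≢v′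
    where
    outside : ∀ {v u t v′} → Leg v (u ∷ t) → 3 ≤ deg G v′ → Beyond u v v′
    outside {v′ = v′} leg deg≥3 with ~⇒±1 v′ (leg-head leg)
    ... | inj₂ p = p
    ... | inj₁ p = contradiction
      (≤-trans deg≥3 (All.lookup (leg-low-degree leg) (leg-covers leg p))) (n≮n 2)
    open ≡-Reasoning
    loop : d x v + (d v′ v + d v v′) ≡ d x v + 0
    loop = begin
      d x v + (d v′ v + d v v′)  ≡⟨ cong (d x v +_) (+-comm (d v′ v) (d v v′)) ⟩
      d x v + (d v v′ + d v′ v)  ≡⟨ +-assoc (d x v) (d v v′) (d v′ v) ⟨
      d x v + d v v′ + d v′ v    ≡⟨ cong (_+ d v′ v) (separation (leg-head leg) (All.lookup inside x∈) (outside leg (proj₁ th′))) ⟨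
      d x v′ + d v′ v            ≡⟨ separation (leg-head leg′) (All.lookup inside′ x∈′) (outside leg′ (proj₁ th)) ⟨
      d x v                      ≡⟨ +-identityʳ (d x v) ⟨
      d x v + 0                  ∎

  -- With all degrees at most 2 the leg can be continued until it meets a leaf. The distance from v
  -- rises at each step and stays below n, so fuel n is enough.
  thread-beyond : ∀ {v u} → 3 ≤ deg G v → v ~ u → (∀ s → Beyond v u s → deg G s ≤ 2) →
    ∃ λ t → IsThread G v (u ∷ t) × All (Beyond v u) (u ∷ t)
  thread-beyond {v} {u} deg≥3 vu low =
    let t , leg = grow n vu (beyond-self (~-sym vu)) (beyond-self vu) (m≤n+m n (d v u))
    in t , leg⇒thread deg≥3 leg , leg-beyond vu leg (beyond-self (~-sym vu)) (beyond-self vu)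
    where
    grow : ∀ f {q p} → q ~ p → Beyond p q v → Beyond v u p → n ≤ d v p + f → ∃ λ t → Leg q (p ∷ t)
    grow zero {p = p} _ _ _ n≤ = contradiction (≤-trans (d<n v p) (subst (n ≤_) (+-identityʳ _) n≤)) (n≮n _)
    grow (suc f) {q} {p} qp up b n≤ with other-neighbour (low p b) qp
    ... | inj₁ e = [] , end qp e
    ... | inj₂ (e , p′ , pp′ , q≢p′) =
      let up′ = leg-child v qp pp′ q≢p′ up
          t , leg = grow f pp′ up′ (beyond-trans vu pp′ b up′ (beyond-self pp′))
                      (subst (n ≤_) (trans (+-suc (d v p) f) (cong (_+ f) (sym up′))) n≤)
      in p′ ∷ t , next qp e q≢p′ leg

  -- The certificate that C contains at least ⌈k/2⌉ vertices of S_k(T). C will be a component left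
  -- by deleting a vertex, a union of two such, or the set of vertices that tell x and y apart by at
  -- least 2.
  record Fork (C : V → Set) : Set where
    constructor fork
    field
      {root}    : V
      {t t′}    : List V
      thread    : IsThread G root t
      thread′   : IsThread G root t′
      distinct  : t ≢ t′
      contained : All C t
      contained′ : All C t′

  fork-map : ∀ {C D : V → Set} → (∀ {s} → C s → D s) → Fork C → Fork D
  fork-map f (fork th th′ t≢t′ c c′) = fork th th′ t≢t′ (All.map f c) (All.map f c′)

  fork-at : ∀ {v c c′} {C : V → Set} → 3 ≤ deg G v → v ~ c → v ~ c′ → c ≢ c′ →
    (∀ s → Beyond v c s → deg G s ≤ 2) → (∀ s → Beyond v c′ s → deg G s ≤ 2) →
    (∀ {s} → Beyond v c s → C s) → (∀ {s} → Beyond v c′ s → C s) → Fork C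
  fork-at deg≥3 vc vc′ c≢c′ low low′ into into′ =
    let _ , th , inside = thread-beyond deg≥3 vc low
        _ , th′ , inside′ = thread-beyond deg≥3 vc′ low′
    in fork th th′ (λ eq → c≢c′ (∷-injectiveˡ eq)) (All.map into inside) (All.map into′ inside′)

  BranchBeyond : V → V → Set
  BranchBeyond w u = ∃ λ s → Beyond w u s × 3 ≤ deg G s

  branchBeyond? : ∀ w u → Dec (BranchBeyond w u)
  branchBeyond? w u = Fin.any? λ s → (d s w ≟ suc (d s u)) ×-dec (3 ≤? deg G s)

  no-branch : ∀ {w u} → ¬ BranchBeyond w u → ∀ s → Beyond w u s → deg G s ≤ 2
  no-branch ¬branch s b = ≤-pred (≰⇒> λ deg≥3 → ¬branch (s , b , deg≥3))

  -- From a branch vertex b, two neighbours lead away from w. If there is a branch vertex beyond one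
  -- of them, the search moves to it and gets farther from w, which bounds the number of moves;
  -- otherwise both components are threads at b.
  fork-beyond : ∀ {w u} → w ~ u → BranchBeyond w u → Fork (Beyond w u)
  fork-beyond {w} {u} wu (b , wb , deg≥3) = search-from n b wb deg≥3 (m≤n+m n (d w b))
    where
    search-from : ∀ f b → Beyond w u b → 3 ≤ deg G b → n ≤ d w b + f → Fork (Beyond w u)
    farther : ∀ f {b c s} → b ~ c → Beyond c b w → Beyond w u b → n ≤ d w b + suc f →
      Beyond b c s → 3 ≤ deg G s → Fork (Beyond w u)
    search-from zero b _ _ n≤ = contradiction (≤-trans (d<n w b) (subst (n ≤_) (+-identityʳ _) n≤)) (n≮n _)
    search-from (suc f) b wb deg≥3 n≤ =
      let c , c′ , c≢c′ , (bc , up) , (bc′ , up′) = two-children w deg≥3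
      in split c≢c′ bc up bc′ up′ (branchBeyond? b c) (branchBeyond? b c′)
      where
      split : ∀ {c c′} → c ≢ c′ → b ~ c → Beyond c b w → b ~ c′ → Beyond c′ b w →
        Dec (BranchBeyond b c) → Dec (BranchBeyond b c′) → Fork (Beyond w u)
      split _ bc up _ _ (yes (s , bs , deg≥3′)) _ = farther f bc up wb n≤ bs deg≥3′
      split _ _ _ bc′ up′ (no _) (yes (s , bs , deg≥3′)) = farther f bc′ up′ wb n≤ bs deg≥3′
      split c≢c′ bc up bc′ up′ (no low) (no low′) =
        fork-at deg≥3 bc bc′ c≢c′ (no-branch low) (no-branch low′)
          (beyond-trans wu bc wb up) (beyond-trans wu bc′ wb up′)
    farther f {b} {c} {s} bc up wb n≤ bs deg≥3 =
      search-from f s (beyond-trans wu bc wb up bs) deg≥3 (begin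
        n                    ≤⟨ n≤ ⟩
        d w b + suc f        ≡⟨ +-suc (d w b) f ⟩
        suc (d w b) + f      ≤⟨ +-monoˡ-≤ f rise ⟩
        d w s + f            ∎)
      where
      open ≤-Reasoning
      rise : suc (d w b) ≤ d w s
      rise = begin
        suc (d w b)              ≤⟨ s≤s (m≤n+m (d w b) (d s c)) ⟩
        suc (d s c) + d w b      ≡⟨ cong₂ _+_ (sym bs) (d-sym w b) ⟩
        d s b + d b w            ≡⟨ separation bc bs up ⟨
        d s w                    ≡⟨ d-sym s w ⟩
        d w s                    ∎

farthest : ∀ {n} (f : Fin n → ℕ) → Fin n → ∃ λ o → ∀ v → f v ≤ f o
farthest f v₀ = argmax f v₀ (allFin _) , λ v → All.lookup (f[xs]≤f[argmax] v₀ (allFin _)) (∈-allFin v)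

-- Trees of maximum degree at most 2 are paths

module PathFromLeaf {n : ℕ} (G : Graph n) (tree : IsTree G) (deg≤2 : ∀ v → deg G v ≤ 2)
  (o : Fin n) (leaf : deg G o ≤ 1) (top : Fin n) (highest : ∀ v → dist G o v ≤ dist G o top) where

  open Threads G tree

  -- By induction both vertices have the same parent p. If p is `o`, it has one neighbour; otherwise
  -- one of its at most two neighbours is its own parent.
  level-unique : ∀ h {a b} → d o a ≡ h → d o b ≡ h → a ≡ b
  level-unique zero oa ob = trans (sym (d-zero oa)) (d-zero ob)
  level-unique (suc h) {a} {b} oa ob =
    let p , pa , op = d-pred oa
        q , qb , oq = d-pred ob
    in siblings h op pa (subst (_~ b) (level-unique h oq op) qb) oa ob
    where
    siblings : ∀ h {p} → d o p ≡ h → p ~ a → p ~ b → d o a ≡ suc h → d o b ≡ suc h → a ≡ b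
    siblings zero op pa pb _ _ with d-zero op
    ... | refl = second-neighbour leaf pa pb
    siblings (suc h) {p} op pa pb oa ob =
      let g , gp , og = d-pred op
          below : ∀ {v} → g ≡ v → ¬ d o v ≡ suc (suc h)
          below = λ g≡v ov → m≢1+n+m h {1} (trans (sym og) (trans (cong (d o) g≡v) ov))
      in pick below (third-neighbour (deg≤2 p) (~-sym gp) pa pb (λ g≡a → below g≡a oa))
      where
      pick : ∀ {g} → (∀ {v} → g ≡ v → ¬ d o v ≡ suc (suc h)) → b ≡ g ⊎ b ≡ a → a ≡ b
      pick below (inj₁ b≡g) = contradiction ob (below (sym b≡g))
      pick _ (inj₂ b≡a) = sym b≡a
  highest′ : ∀ v → d o v ≤ d o top
  highest′ v = subst₂ _≤_ (sym (d≡dist o v)) (sym (d≡dist o top)) (highest v)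
  -- Pigeonhole: distances from `o` are pairwise different and at most d o top. Hence every distance
  -- below n occurs, and `π i` can be the vertex at distance i.
  height : n ≤ suc (d o top)
  height = Fin.injective⇒≤ {f = λ v → fromℕ< (s≤s (highest′ v))} λ {a} {b} eq →
    level-unique (d o b) (trans (sym (Fin.toℕ-fromℕ< _)) (trans (cong toℕ eq) (Fin.toℕ-fromℕ< _))) refl
  vertex : (i : Fin n) → ∃ λ v → d o v ≡ toℕ i
  vertex i = let v , ov , _ = between (toℕ i) (d o top ∸ toℕ i)
                   (sym (m+[n∸m]≡n (≤-pred (≤-trans (Fin.toℕ<n i) height))))
             in v , ov
  π : Fin n → Fin n
  π i = proj₁ (vertex i)
  level : ∀ i → d o (π i) ≡ toℕ i
  level i = proj₂ (vertex i)
  π-injective : ∀ i j → π i ≡ π j → i ≡ j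
  π-injective i j eq = Fin.toℕ-injective (trans (sym (level i)) (trans (cong (d o) eq) (level j)))
  to : ∀ i j → π i ~ π j → suc (toℕ i) ≡ toℕ j ⊎ suc (toℕ j) ≡ toℕ i
  to i j ij with ~⇒±1 o ij
  ... | inj₁ p = inj₂ (trans (cong suc (sym (level j))) (trans (sym p) (level i)))
  ... | inj₂ p = inj₁ (trans (cong suc (sym (level i))) (trans (sym p) (level j)))
  up : ∀ i j → suc (toℕ i) ≡ toℕ j → π i ~ π j
  up i j eq = let w , wj , ow = d-pred (trans (level j) (sym eq)) in
    subst (_~ π j) (level-unique (toℕ i) ow (level i)) wj
  from : ∀ i j → suc (toℕ i) ≡ toℕ j ⊎ suc (toℕ j) ≡ toℕ i → π i ~ π j
  from i j (inj₁ eq) = up i j eq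
  from i j (inj₂ eq) = ~-sym (up j i eq)

  isPath : IsPathGraph G
  isPath = π , π-injective , λ i j → mk⇔ (to i j) (from i j)

-- A vertex farthest from any given one is a leaf.
leaf-exists : ∀ {n} (G : Graph n) → IsTree G → Fin n → ∃ λ o → deg G o ≤ 1
leaf-exists G tree v₀ = let o , highest = farthest (d v₀) v₀ in
  o , neighbours-rec o (λ _ → deg G o ≤ 1) (few o highest)
  where
  open Threads G tree
  few : ∀ o → (∀ v → d v₀ v ≤ d v₀ o) →
    ∀ ns → Unique ns → All (o ~_) ns → length ns ≡ deg G o → deg G o ≤ 1
  few o highest [] _ _ eq = subst (_≤ 1) eq z≤n
  few o highest (_ ∷ []) _ _ eq = subst (_≤ 1) eq (s≤s z≤n)
  few o highest (a ∷ b ∷ _) ((a≢b ∷ _) ∷ _) (oa ∷ ob ∷ _) _ =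
    contradiction (beyond-unique oa ob (inward oa) (inward ob)) a≢b
    where
    inward : ∀ {a} → o ~ a → Beyond o a v₀
    inward {a} oa with ~⇒±1 v₀ oa
    ... | inj₁ p = p
    ... | inj₂ p = contradiction (subst (_≤ d v₀ o) p (highest a)) (n≮n _)

deg≤2⇒path : ∀ {n} (G : Graph n) → IsTree G → (∀ v → deg G v ≤ 2) → IsPathGraph G
deg≤2⇒path {zero} G _ _ = (λ i → i) , (λ ()) , (λ ())
deg≤2⇒path {suc m} G tree deg≤2 =
  let o , leaf = leaf-exists G tree zero
      top , highest = farthest (dist G o) o
  in PathFromLeaf.isPath G tree deg≤2 o leaf top highest

-- Sizes of the sets S_k(v)

≤-half : ∀ {k c} → k ≤ 2 * c → ⌈ k /2⌉ ≤ c
≤-half {k} {c} k≤2c = begin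
  (k + 1) / 2      ≡⟨ cong (_/ 2) (+-comm k 1) ⟩
  (1 + k) / 2      ≤⟨ /-monoˡ-≤ 2 (+-monoʳ-≤ 1 (≤-trans k≤2c (≤-reflexive (*-comm 2 c)))) ⟩
  (1 + c * 2) / 2  ≡⟨ +-distrib-/-∣ʳ 1 {c * 2} {2} (divides c refl) ⟩
  c * 2 / 2        ≡⟨ m*n/n≡m c 2 ⟩
  c                ∎
  where open ≤-Reasoning

half-≤ : ∀ k → k ≤ ⌈ k /2⌉ * 2
half-≤ k = +-cancelʳ-≤ 1 k _ (begin
  k + 1                              ≡⟨ m≡m%n+[m/n]*n (k + 1) 2 ⟩
  (k + 1) % 2 + (k + 1) / 2 * 2      ≤⟨ +-monoˡ-≤ _ (≤-pred (m%n<n (k + 1) 2)) ⟩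
  1 + (k + 1) / 2 * 2                ≡⟨ +-comm 1 _ ⟩
  (k + 1) / 2 * 2 + 1                ∎)
  where open ≤-Reasoning

-- Writing k = r + 4q leaves four values of r. With c = ⌈k/4⌉, ⌈k/2⌉ is 2c - 1 or 2c; h stands for c
-- - 1, to avoid truncated subtraction.
quarter-half : ∀ k → 1 ≤ k → ∃ λ h → ⌈ k /4⌉ ≡ suc h ×
  ((k≡1,2mod4 k ≡ true × ⌈ k /2⌉ ≡ h + suc h) ⊎ (k≡1,2mod4 k ≡ false × ⌈ k /2⌉ ≡ suc h + suc h))
quarter-half k 1≤k with k divMod 4
... | result q r refl = cases r q 1≤k
  where
  quarter : ∀ r q → ⌈ r + q * 4 /4⌉ ≡ (r + 3) / 4 + q
  quarter r q = begin
    (r + q * 4 + 3) / 4        ≡⟨ cong (_/ 4) (trans (+-assoc r (q * 4) 3) (trans (cong (r +_) (+-comm (q * 4) 3)) (sym (+-assoc r 3 (q * 4))))) ⟩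
    (r + 3 + q * 4) / 4        ≡⟨ +-distrib-/-∣ʳ (r + 3) (divides q refl) ⟩
    (r + 3) / 4 + q * 4 / 4    ≡⟨ cong ((r + 3) / 4 +_) (m*n/n≡m q 4) ⟩
    (r + 3) / 4 + q            ∎
    where open ≡-Reasoning
  half : ∀ r q → ⌈ r + q * 4 /2⌉ ≡ (r + 1) / 2 + (q + q)
  half r q = begin
    (r + q * 4 + 1) / 2              ≡⟨ cong (_/ 2) (trans (+-assoc r (q * 4) 1) (trans (cong (r +_) (+-comm (q * 4) 1)) (sym (+-assoc r 1 (q * 4))))) ⟩
    (r + 1 + q * 4) / 2              ≡⟨ cong (λ x → (r + 1 + x) / 2) (trans (sym (*-assoc q 2 2)) (cong (_* 2) (trans (*-comm q 2) (cong (q +_) (+-identityʳ q))))) ⟩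
    (r + 1 + (q + q) * 2) / 2        ≡⟨ +-distrib-/-∣ʳ (r + 1) (divides (q + q) refl) ⟩
    (r + 1) / 2 + (q + q) * 2 / 2    ≡⟨ cong ((r + 1) / 2 +_) (m*n/n≡m (q + q) 2) ⟩
    (r + 1) / 2 + (q + q)            ∎
    where open ≡-Reasoning
  class : ∀ r q → k≡1,2mod4 (r + q * 4) ≡ (r % 4 ≡ᵇ 1) ∨ (r % 4 ≡ᵇ 2)
  class r q = cong (λ x → (x ≡ᵇ 1) ∨ (x ≡ᵇ 2)) ([m+kn]%n≡m%n r q 4)
  cases : ∀ (r : Fin 4) q → let k = toℕ r + q * 4 in 1 ≤ k → ∃ λ h → ⌈ k /4⌉ ≡ suc h ×
    ((k≡1,2mod4 k ≡ true × ⌈ k /2⌉ ≡ h + suc h) ⊎ (k≡1,2mod4 k ≡ false × ⌈ k /2⌉ ≡ suc h + suc h))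
  cases zero (suc q) _ = q , quarter 0 (suc q) , inj₂ (class 0 (suc q) , half 0 (suc q))
  cases (suc zero) q _ = q , quarter 1 q , inj₁ (class 1 q , trans (half 1 q) (sym (+-suc q q)))
  cases (suc (suc zero)) q _ = q , quarter 2 q , inj₁ (class 2 q , trans (half 2 q) (sym (+-suc q q)))
  cases (suc (suc (suc zero))) q _ =
    q , quarter 3 q , inj₂ (class 3 q , trans (half 3 q) (cong suc (sym (+-suc q q))))

-- Every case of the definition of S_k(v) takes the first a vertices of the shortest thread and
-- the first b vertices of each other one, with a + b = ⌈k/2⌉.
record Shape {A : Set} (k : ℕ) (P₁ : List A) (rest : List (List A)) : Set where
  field
    a b      : ℕ
    a+b      : a + b ≡ ⌈ k /2⌉
    a≤b      : a ≤ b
    a≤l₁     : a ≤ length P₁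
    balanced : (b ≤ suc a × b ≤ length P₁) ⊎ a ≡ length P₁
    Sk-shape : Sk k (P₁ ∷ rest) ≡ take a P₁ ++ concat (map (take b) rest)
    fk-shape : fk k (P₁ ∷ rest) ≡ a + length rest * b

-- If ⌈k/4⌉ = h + 1 ≤ l₁, then (a, b) is (h, h + 1) or (h + 1, h + 1), which gives the left side of
-- `balanced`. Otherwise a = l₁, the shortest thread is used up, and b = ⌈k/2⌉ - l₁.
shape : ∀ {A : Set} k (P₁ : List A) rest → 1 ≤ k → Shape k P₁ rest
shape k P₁ rest 1≤k with quarter-half k 1≤k
... | h , c≡ , m≡ with ⌈ k /4⌉ ≤ᵇ length P₁ in c≤ᵇl₁
shape k P₁ rest 1≤k | h , c≡ , inj₁ (odd , m≡) | true = record
  { a = h ; b = suc h ; a+b = sym m≡ ; a≤b = n≤1+n h ; a≤l₁ = ≤-trans (n≤1+n h) c≤l₁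
  ; balanced = inj₁ (≤-refl , c≤l₁)
  ; Sk-shape = Sk≡
  ; fk-shape = fk≡ }
  where
  c≤l₁ : suc h ≤ length P₁
  c≤l₁ = subst (_≤ length P₁) c≡ (≤ᵇ⇒≤ _ _ (subst T (sym c≤ᵇl₁) _))
  Sk≡ : Sk k (P₁ ∷ rest) ≡ take h P₁ ++ concat (map (take (suc h)) rest)
  Sk≡ rewrite c≤ᵇl₁ | odd | c≡ = refl
  fk≡ : fk k (P₁ ∷ rest) ≡ h + length rest * suc h
  fk≡ rewrite c≤ᵇl₁ | odd | c≡ = cong (_∸ 1) (*-comm (suc h) (suc (length rest)))
shape k P₁ rest 1≤k | h , c≡ , inj₂ (even , m≡) | true = record
  { a = suc h ; b = suc h ; a+b = sym m≡ ; a≤b = ≤-refl ; a≤l₁ = c≤l₁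
  ; balanced = inj₁ (n≤1+n (suc h) , c≤l₁)
  ; Sk-shape = Sk≡
  ; fk-shape = fk≡ }
  where
  c≤l₁ : suc h ≤ length P₁
  c≤l₁ = subst (_≤ length P₁) c≡ (≤ᵇ⇒≤ _ _ (subst T (sym c≤ᵇl₁) _))
  Sk≡ : Sk k (P₁ ∷ rest) ≡ take (suc h) P₁ ++ concat (map (take (suc h)) rest)
  Sk≡ rewrite c≤ᵇl₁ | even | c≡ = refl
  fk≡ : fk k (P₁ ∷ rest) ≡ suc h + length rest * suc h
  fk≡ rewrite c≤ᵇl₁ | even | c≡ = *-comm (suc h) (suc (length rest))
shape k P₁ rest 1≤k | h , c≡ , m≡ | false = record
  { a = length P₁ ; b = ⌈ k /2⌉ ∸ length P₁
  ; a+b = m+[n∸m]≡n (≤-trans (m≤m+n (length P₁) (length P₁)) 2l₁≤m)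
  ; a≤b = m+n≤o⇒m≤o∸n (length P₁) 2l₁≤m ; a≤l₁ = ≤-refl
  ; balanced = inj₂ refl
  ; Sk-shape = Sk≡
  ; fk-shape = fk≡ }
  where
  l₁≤h : length P₁ ≤ h
  l₁≤h = ≤-pred (subst (length P₁ <_) c≡ (≰⇒> λ le → subst T c≤ᵇl₁ (≤⇒≤ᵇ le)))
  -- This makes the truncated subtraction in `b` exact and yields a ≤ b.
  2l₁≤m : length P₁ + length P₁ ≤ ⌈ k /2⌉
  2l₁≤m = double m≡
    where
    double : (k≡1,2mod4 k ≡ true × ⌈ k /2⌉ ≡ h + suc h) ⊎ (k≡1,2mod4 k ≡ false × ⌈ k /2⌉ ≡ suc h + suc h) →
      length P₁ + length P₁ ≤ ⌈ k /2⌉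
    double (inj₁ (_ , e)) = subst (length P₁ + length P₁ ≤_) (sym e) (+-mono-≤ l₁≤h (≤-trans l₁≤h (n≤1+n h)))
    double (inj₂ (_ , e)) = subst (length P₁ + length P₁ ≤_) (sym e) (+-mono-≤ (≤-trans l₁≤h (n≤1+n h)) (≤-trans l₁≤h (n≤1+n h)))
  Sk≡ : Sk k (P₁ ∷ rest) ≡ take (length P₁) P₁ ++ concat (map (take (⌈ k /2⌉ ∸ length P₁)) rest)
  Sk≡ rewrite c≤ᵇl₁ | take-all (length P₁) P₁ ≤-refl = refl
  fk≡ : fk k (P₁ ∷ rest) ≡ length P₁ + length rest * (⌈ k /2⌉ ∸ length P₁)
  fk≡ rewrite c≤ᵇl₁ = refl

-- Only an inequality, since `take` may return fewer vertices than asked for. Equality of the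
-- cardinalities will follow from the lower bound.
length-Sk : ∀ {A : Set} {k} (ts : List (List A)) → 1 ≤ k → length (Sk k ts) ≤ fk k ts
length-Sk [] _ = z≤n
length-Sk {k = k} (P₁ ∷ rest) 1≤k = begin
  length (Sk k (P₁ ∷ rest))                              ≡⟨ cong length Sk-shape ⟩
  length (take a P₁ ++ concat (map (take b) rest))       ≡⟨ length-++ (take a P₁) ⟩
  length (take a P₁) + length (concat (map (take b) rest)) ≤⟨ +-mono-≤ (short a P₁) (shorts rest) ⟩
  a + length rest * b                                    ≡⟨ fk-shape ⟨
  fk k (P₁ ∷ rest)                                       ∎
  where
  open ≤-Reasoning
  open Shape (shape k P₁ rest 1≤k)
  short : ∀ c (t : List _) → length (take c t) ≤ c
  short c t = subst (_≤ c) (sym (length-take c t)) (m⊓n≤m c (length t))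
  shorts : ∀ ts → length (concat (map (take b) ts)) ≤ length ts * b
  shorts [] = z≤n
  shorts (t ∷ ts) = subst (_≤ b + length ts * b) (sym (length-++ (take b t))) (+-mono-≤ (short b t) (shorts ts))

-- Sums of numbers whose pairwise sums are at least a + b

module _ {a b : ℕ} where

  private
    Large : ℕ → ℕ → Set
    Large x y = a + b ≤ x + y

  large⇒≥b : ∀ {g x} → g ≤ a → Large g x → b ≤ x
  large⇒≥b {g} {x} g≤a le = +-cancelˡ-≤ a b x (≤-trans le (+-monoˡ-≤ x g≤a))

  -- With one entry g ≤ a, all others are at least a + b - g.
  sum-with-small : ∀ {x y} zs → AllPairs Large (x ∷ y ∷ zs) → Any (_≤ a) (x ∷ y ∷ zs) →
    a + suc (length zs) * b ≤ x + (y + sum zs)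
  sum-with-small {x} {y} [] ((xy ∷ []) ∷ _) _ =
    subst₂ _≤_ (cong (a +_) (sym (+-identityʳ b))) (cong (x +_) (sym (+-identityʳ y))) xy
  sum-with-small {x} {y} (z ∷ zs) ((xy ∷ xzs) ∷ (yzs ∷ ps)) (here x≤a) = begin
    a + (b + suc (length zs) * b)  ≡⟨ x∙yz≈y∙xz a b _ ⟩
    b + (a + suc (length zs) * b)  ≤⟨ +-mono-≤ (large⇒≥b x≤a xy) (sum-with-small zs (xzs ∷ ps) (here x≤a)) ⟩
    y + (x + (z + sum zs))         ≡⟨ x∙yz≈y∙xz y x _ ⟩
    x + (y + (z + sum zs))         ∎
    where
    open ≤-Reasoning
  sum-with-small {x} {y} (z ∷ zs) ((xy ∷ xzs) ∷ ps) (there small) = begin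
    a + (b + suc (length zs) * b)  ≡⟨ x∙yz≈y∙xz a b _ ⟩
    b + (a + suc (length zs) * b)  ≤⟨ +-mono-≤ (first small (xy ∷ xzs)) (sum-with-small zs ps small) ⟩
    x + (y + (z + sum zs))         ∎
    where
    open ≤-Reasoning
    first : ∀ {ys} → Any (_≤ a) ys → All (Large x) ys → b ≤ x
    first (here g≤a) (p ∷ _) = large⇒≥b g≤a (subst (a + b ≤_) (+-comm x _) p)
    first (there q) (_ ∷ ps) = first q ps

  -- Either some entry is at most a, and the previous lemma applies, or every entry is at least a +
  -- 1. The latter rules out x ≤ a, and b ≤ a + 1 then makes each entry of `ys` at least b.
  sum-lower : ∀ {x} ys → 1 ≤ length ys → AllPairs Large (x ∷ ys) → b ≤ suc a ⊎ x ≤ a →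
    a + length ys * b ≤ x + sum ys
  sum-lower {x} (y ∷ zs) _ large bal with Any.any? (_≤? a) (x ∷ y ∷ zs) | bal
  ... | yes small | _ = sum-with-small zs large small
  ... | no none | inj₂ x≤a = contradiction (here x≤a) none
  ... | no none | inj₁ b≤1+a with All.¬Any⇒All¬ (x ∷ y ∷ zs) none
  ...   | x≰a ∷ big = +-mono-≤ (<⇒≤ (≰⇒> x≰a)) (all-big big)
    where
    all-big : ∀ {ys} → All (λ y → ¬ y ≤ a) ys → length ys * b ≤ sum ys
    all-big [] = z≤n
    all-big (y≰a ∷ ps) = +-mono-≤ (≤-trans b≤1+a (≰⇒> y≰a)) (all-big ps)

-- The two bounds

Unique⇒AllPairs : ∀ {A : Set} {P : A → Set} {Q : A → A → Set} {xs} →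
  (∀ {x y} → P x → P y → x ≢ y → Q x y) → All P xs → Unique xs → AllPairs Q xs
Unique⇒AllPairs f [] [] = []
Unique⇒AllPairs f (p ∷ ps) (x≢ ∷ u) =
  All.zipWith (λ { (q , x≢y) → f p q x≢y }) (ps , x≢) ∷ Unique⇒AllPairs f ps u

∣-∣≤ : ∀ {m n c} → m ≤ n + c → n ≤ m + c → ∣ m - n ∣ ≤ c
∣-∣≤ {m} {n} {c} p q with ∣m-n∣≡[m∸n]∨[n∸m] m n
... | inj₁ e = subst (_≤ c) (sym e) (m≤n+o⇒m∸n≤o m n p)
... | inj₂ e = subst (_≤ c) (sym e) (m≤n+o⇒m∸n≤o n m q)

halve : ∀ D → ∃ λ h → D ≡ h + h ⊎ D ≡ h + suc h
halve zero = 0 , inj₁ refl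
halve (suc D) with halve D
... | h , inj₁ e = h , inj₂ (trans (cong suc e) (sym (+-suc h h)))
... | h , inj₂ e = suc h , inj₁ (cong suc e)

module Resolving {n : ℕ} (T : Graph n) (tree : IsTree T) (k : ℕ) where

  open Threads T tree public

  private
    V : Set
    V = Fin n
    m : ℕ
    m = ⌈ k /2⌉

  dist-near : ∀ {a b s c} → ∣ d a s - d b s ∣ ≤ c → ∣ dist T a s - dist T b s ∣ ≤ c
  dist-near {a} {b} {s} {c} = subst₂ (λ i j → ∣ i - j ∣ ≤ c) (d≡dist a s) (d≡dist b s)

  dist-far : ∀ {a b s c} → c ≤ ∣ d a s - d b s ∣ → c ≤ ∣ dist T a s - dist T b s ∣
  dist-far {a} {b} {s} {c} = subst₂ (λ i j → c ≤ ∣ i - j ∣) (d≡dist a s) (d≡dist b s)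

  -- Here w is the midpoint and p its neighbour towards x. A vertex s beyond p reaches y only
  -- through p and w, at distance h + 2 from p, while x is at distance h from p.
  half-way : ∀ {x y w p h} → p ~ w → d x p ≡ h → d w y ≡ suc h → d x y ≡ suc h + suc h →
    Beyond w p x × Beyond p w y × (∀ {s} → Beyond w p s → 2 ≤ ∣ d x s - d y s ∣)
  half-way {x} {y} {w} {p} {h} pw xp wy xy =
    let y-beyond , x-beyond = geodesic-edge pw
          (trans xy (sym (trans (cong₂ (λ i j → i + suc j) xp wy) (+-suc h (suc h)))))
    in x-beyond , y-beyond , λ b → far-apart 2 pw y-beyond b
         (≤-reflexive (trans (cong (2 +_) (trans (d-sym p x) xp)) (cong suc (sym wy))))

  -- Resolving the two heads forces this: a vertex off both threads sees each head one step past v,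
  -- and no vertex sees them more than 2 apart.
  thread-pair : ∀ {S v t t′} → WeakResolving T k S → IsThread T v t → IsThread T v t′ → t ≢ t′ →
    m ≤ count S t + count S t′
  thread-pair {S} {v} res th th′ t≢t′ with thread-view th | thread-view th′
  ... | view {u} {r} refl leg _ | view {u′} {r′} refl leg′ _ = ≤-half (begin
    k                                            ≤⟨ res u u′ u≢u′ ⟩
    ΔS T S u u′                                  ≤⟨ ΔS-upper T S u u′ 2 ((u ∷ r) ++ (u′ ∷ r′)) near covered ⟩
    2 * count S ((u ∷ r) ++ (u′ ∷ r′))           ≡⟨ cong (2 *_) (sum-map-++ (indicator S) (u ∷ r) (u′ ∷ r′)) ⟩
    2 * (count S (u ∷ r) + count S (u′ ∷ r′))    ∎)
    where
    open ≤-Reasoning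
    vu = leg-head leg
    vu′ = leg-head leg′
    u≢u′ : u ≢ u′
    u≢u′ refl = t≢t′ (cong (u ∷_) (leg-unique leg leg′))
    two-steps : ∀ {a b} s → v ~ a → v ~ b → d a s ≤ d b s + 2
    two-steps {a} {b} s va vb = begin
      d a s               ≤⟨ d-stepˡ s va ⟩
      suc (d v s)         ≤⟨ s≤s (d-stepˡ s (~-sym vb)) ⟩
      suc (suc (d b s))   ≡⟨ +-comm 2 (d b s) ⟩
      d b s + 2           ∎
    near : ∀ s → ∣ dist T u s - dist T u′ s ∣ ≤ 2
    near s = dist-near (∣-∣≤ (two-steps s vu vu′) (two-steps s vu′ vu))
    covered : ∀ s → dist T u s ≢ dist T u′ s → s ∈ (u ∷ r) ++ (u′ ∷ r′)
    covered s du≢du′ with ~⇒±1 s vu | ~⇒±1 s vu′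
    ... | inj₁ b | _ = ∈-++⁺ˡ (leg-covers leg b)
    ... | inj₂ _ | inj₁ b = ∈-++⁺ʳ (u ∷ r) (leg-covers leg′ b)
    ... | inj₂ e | inj₂ e′ = contradiction
      (trans (sym (d≡dist u s)) (trans (d-sym u s) (trans e (trans (sym e′) (trans (d-sym s u′) (d≡dist u′ s)))))) du≢du′

module Labelled {n : ℕ} (T : Graph n) (tree : IsTree T) (k : ℕ) (1≤k : 1 ≤ k)
  (feasible : ∃ (WeakResolving T k)) (R : List (Fin n)) (R-unique : Unique R)
  (R-roots : ∀ v → (v ∈ R) ⇔ IsRoot T v) (lab : Fin n → List (List (Fin n)))
  (lab-ok : ∀ v → v ∈ R → IsLabelling T v (lab v)) where

  open Resolving T tree k

  private
    V : Set
    V = Fin n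
    m : ℕ
    m = ⌈ k /2⌉
    S : Subset n
    S = SkT k R lab

  two-threads : ∀ {v} → v ∈ R → ∃₂ λ P₁ P₂ → ∃ λ rest → lab v ≡ P₁ ∷ P₂ ∷ rest
  two-threads {v} v∈R =
    let _ , t , t′ , t≢t′ , th , th′ = Equivalence.to (R-roots v) v∈R
        complete = proj₁ (proj₂ (lab-ok v v∈R))
    in split t≢t′ (complete t th) (complete t′ th′)
    where
    split : ∀ {t t′ ts} → t ≢ t′ → t ∈ ts → t′ ∈ ts → ∃₂ λ P₁ P₂ → ∃ λ rest → ts ≡ P₁ ∷ P₂ ∷ rest
    split {ts = _ ∷ []} t≢t′ (here refl) (here refl) = contradiction refl t≢t′
    split {ts = _ ∷ _ ∷ _} _ _ _ = _ , _ , _ , refl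

  root-lower : ∀ {S v} → WeakResolving T k S → v ∈ R → fk k (lab v) ≤ count S (concat (lab v))
  root-lower {S} {v} res v∈R with two-threads v∈R
  ... | P₁ , P₂ , rest , eq with subst (IsLabelling T v) eq (lab-ok v v∈R)
  ...   | threads , _ , unique , _ = subst (λ ts → fk k ts ≤ count S (concat ts)) (sym eq) (begin
    fk k (P₁ ∷ P₂ ∷ rest)                            ≡⟨ fk-shape ⟩
    a + suc (length rest) * b                        ≡⟨ cong (λ l → a + suc l * b) (length-map (count S) rest) ⟨
    a + suc (length (map (count S) rest)) * b        ≤⟨ sum-lower _ (s≤s z≤n) (AllPairs.map⁺ pairs) small ⟩
    sum (map (count S) (P₁ ∷ P₂ ∷ rest))             ≡⟨ sum-map-concat (indicator S) (P₁ ∷ P₂ ∷ rest) ⟨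
    count S (concat (P₁ ∷ P₂ ∷ rest))                ∎)
    where
    open ≤-Reasoning
    open Shape (shape k P₁ (P₂ ∷ rest) 1≤k)
    pairs : AllPairs (λ t t′ → a + b ≤ count S t + count S t′) (P₁ ∷ P₂ ∷ rest)
    pairs = Unique⇒AllPairs (λ th th′ t≢t′ → ≤-trans (≤-reflexive a+b) (thread-pair {S} res th th′ t≢t′)) threads unique
    -- When a is the full length of the shortest thread, no set can have more than a vertices on it.
    small : b ≤ suc a ⊎ count S P₁ ≤ a
    small with balanced
    ... | inj₁ (b≤1+a , _) = inj₁ b≤1+a
    ... | inj₂ a≡ = inj₂ (subst (count S P₁ ≤_) (sym a≡) (count≤length S P₁))

  -- Disjointness within a root and between roots; it lets the counts forced at the separate roots
  -- add up inside one set.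
  threads-unique : Unique (concat (map (concat ∘ lab) R))
  threads-unique = Unique.concat⁺
    (All.map⁺ (All.tabulate λ v∈R → Unique.concat⁺
      (All.map (λ { (_ , (_ ∷ u) , _) → u }) (proj₁ (lab-ok _ v∈R)))
      (Unique⇒AllPairs (λ th th′ t≢t′ → λ { (x∈ , x∈′) → t≢t′ (proj₂ (threads-disjoint th th′ x∈ x∈′)) })
        (proj₁ (lab-ok _ v∈R)) (proj₁ (proj₂ (proj₂ (lab-ok _ v∈R)))))))
    (AllPairs.map⁺ (Unique⇒AllPairs apart (All.tabulate λ v∈R → v∈R) R-unique))
    where
    apart : ∀ {v v′} → v ∈ R → v′ ∈ R → v ≢ v′ → ∀ {x} → ¬ (x ∈ concat (lab v) × x ∈ concat (lab v′))
    apart {v} {v′} v∈R v′∈R v≢v′ (x∈ , x∈′) =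
      let t , x∈t , t∈ = ∈-concat⁻′ (lab v) x∈
          t′ , x∈t′ , t′∈ = ∈-concat⁻′ (lab v′) x∈′
      in v≢v′ (proj₁ (threads-disjoint (All.lookup (proj₁ (lab-ok v v∈R)) t∈) (All.lookup (proj₁ (lab-ok v′ v′∈R)) t′∈) x∈t x∈t′))

  lower-bound : ∀ {S} → WeakResolving T k S → ΣfkT k R lab ≤ ∣ S ∣
  lower-bound {S} res = ≤-trans (collect R (λ v∈ → v∈)) (card-lower S threads-unique)
    where
    collect : ∀ vs → (∀ {v} → v ∈ vs → v ∈ R) → ΣfkT k vs lab ≤ count S (concat (map (concat ∘ lab) vs))
    collect [] _ = z≤n
    collect (v ∷ vs) sub = ≤-trans
      (+-mono-≤ (root-lower {S} res (sub (here refl))) (collect vs (sub ∘ there)))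
      (≤-reflexive (sym (sum-map-++ (indicator S) (concat (lab v)) _)))

  upper-bound : ∣ S ∣ ≤ ΣfkT k R lab
  upper-bound = ≤-trans (card-upper S {xs} (toSubset⁻ xs)) (collect R)
    where
    xs : List V
    xs = concat (map (λ v → Sk k (lab v)) R)
    collect : ∀ vs → length (concat (map (λ v → Sk k (lab v)) vs)) ≤ ΣfkT k vs lab
    collect [] = z≤n
    collect (v ∷ vs) = ≤-trans (≤-reflexive (length-++ (Sk k (lab v)))) (+-mono-≤ (length-Sk (lab v) 1≤k) (collect vs))

  Chosen : List V → Set
  Chosen xs = Unique xs × All (λ s → lookup S s ≡ true) xs

  Sk⇒S : ∀ {v s} → v ∈ R → s ∈ Sk k (lab v) → lookup S s ≡ true
  Sk⇒S v∈R s∈ = toSubset⁺ (∈-concat⁺′ s∈ (∈-map⁺ (λ v → Sk k (lab v)) v∈R))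

  -- Two threads contribute initial segments of lengths a and b, or b and b, and a + b = ⌈k/2⌉ with
  -- a ≤ b. The point to check is that the threads are long enough for `take` to be full.
  chosen-parts : ∀ {v t t′} → v ∈ R → t ∈ lab v → t′ ∈ lab v → t ≢ t′ →
    ∃₂ λ i j → m ≤ length (take i t) + length (take j t′) ×
      All (_∈ Sk k (lab v)) (take i t) × All (_∈ Sk k (lab v)) (take j t′)
  chosen-parts {v} {t} {t′} v∈R with two-threads v∈R
  ... | P₁ , P₂ , rest , eq with subst (IsLabelling T v) eq (lab-ok v v∈R)
  ...   | th₁ ∷ threads , _ , (P₁≢ ∷ _) , sorted rewrite eq = parts
    where
    open ≤-Reasoning
    open Shape (shape k P₁ (P₂ ∷ rest) 1≤k)
    others : List (List V)
    others = P₂ ∷ rest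
    long : ∀ {t} → t ∈ others → b ≤ length t
    long {t} t∈ with balanced
    ... | inj₁ (_ , b≤l₁) with Linked⇒AllPairs ≤-trans sorted
    ...   | shortest ∷ _ = ≤-trans b≤l₁ (All.lookup shortest t∈)
    -- Here k ≤ κ matters: the given weak k-resolving set has at least ⌈k/2⌉ vertices on `P₁` and t
    -- together, so these threads have at least that total length.
    long {t} t∈ | inj₂ a≡l₁ = +-cancelˡ-≤ a b (length t) (begin
      a + b                             ≡⟨ a+b ⟩
      m                                 ≤⟨ thread-pair {proj₁ feasible} (proj₂ feasible) th₁ (All.lookup threads t∈) (All.lookup P₁≢ t∈) ⟩
      count (proj₁ feasible) P₁ + count (proj₁ feasible) t ≤⟨ +-mono-≤ (count≤length (proj₁ feasible) P₁) (count≤length (proj₁ feasible) t) ⟩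
      length P₁ + length t              ≡⟨ cong (_+ length t) a≡l₁ ⟨
      a + length t                      ∎)
    full : ∀ {c} {t : List V} → c ≤ length t → length (take c t) ≡ c
    full {c} {t} c≤ = trans (length-take c t) (m≤n⇒m⊓n≡m c≤)
    in-first : All (_∈ Sk k (P₁ ∷ others)) (take a P₁)
    in-first = All.tabulate λ s∈ → subst (_ ∈_) (sym Sk-shape) (∈-++⁺ˡ s∈)
    in-other : ∀ {t} → t ∈ others → All (_∈ Sk k (P₁ ∷ others)) (take b t)
    in-other t∈ = All.tabulate λ s∈ → subst (_ ∈_) (sym Sk-shape)
      (∈-++⁺ʳ (take a P₁) (∈-concat⁺′ s∈ (∈-map⁺ (take b) t∈)))
    parts : ∀ {t t′} → t ∈ P₁ ∷ others → t′ ∈ P₁ ∷ others → t ≢ t′ →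
      ∃₂ λ i j → m ≤ length (take i t) + length (take j t′) ×
        All (_∈ Sk k (P₁ ∷ others)) (take i t) × All (_∈ Sk k (P₁ ∷ others)) (take j t′)
    parts (here refl) (here refl) t≢t′ = contradiction refl t≢t′
    parts (here refl) (there t′∈) _ = a , b ,
      ≤-reflexive (sym (trans (cong₂ _+_ (full a≤l₁) (full (long t′∈))) a+b)) , in-first , in-other t′∈
    parts (there t∈) (here refl) _ = b , a ,
      ≤-reflexive (sym (trans (cong₂ _+_ (full (long t∈)) (full a≤l₁)) (trans (+-comm b a) a+b))) , in-other t∈ , in-first
    parts {t} {t′} (there t∈) (there t′∈) _ = b , b , (begin
      m                                          ≡⟨ a+b ⟨
      a + b                                      ≤⟨ +-monoˡ-≤ b a≤b ⟩
      b + b                                      ≡⟨ cong₂ _+_ (full (long t∈)) (full (long t′∈)) ⟨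
      length (take b t) + length (take b t′)     ∎) , in-other t∈ , in-other t′∈

  fork⇒chosen : ∀ {C : V → Set} → Fork C → ∃ λ xs → Chosen xs × All C xs × m ≤ length xs
  fork⇒chosen {C} (fork {v} {t} {t′} th th′ t≢t′ inC inC′) =
    let v∈R = Equivalence.from (R-roots v) (proj₁ th , t , t′ , t≢t′ , th , th′)
        complete = proj₁ (proj₂ (lab-ok v v∈R))
        i , j , m≤ , in-t , in-t′ = chosen-parts v∈R (complete t th) (complete t′ th′) t≢t′
    in take i t ++ take j t′ ,
       (Unique.++⁺ (Unique.take⁺ i (thread-unique th)) (Unique.take⁺ j (thread-unique th′)) (λ { (x∈ , x∈′) →
          t≢t′ (proj₂ (threads-disjoint th th′ (take-⊆ i x∈) (take-⊆ j x∈′))) }) ,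
        All.++⁺ (All.map (Sk⇒S v∈R) in-t) (All.map (Sk⇒S v∈R) in-t′)) ,
       All.++⁺ (All.take⁺ i inC) (All.take⁺ j inC′) ,
       subst (m ≤_) (sym (length-++ (take i t))) m≤
    where
    thread-unique : ∀ {v t} → IsThread T v t → Unique t
    thread-unique (_ , (_ ∷ u) , _) = u
    take-⊆ : ∀ i {t : List V} {x} → x ∈ take i t → x ∈ t
    take-⊆ (suc i) {_ ∷ _} (here p) = here p
    take-⊆ (suc i) {_ ∷ _} (there p) = there (take-⊆ i p)

  fork⇒resolves : ∀ {x y} → Fork (λ s → 2 ≤ ∣ d x s - d y s ∣) → k ≤ ΔS T S x y
  fork⇒resolves {x} {y} f =
    let xs , (unique , inS) , far , m≤ = fork⇒chosen f in begin
    k                  ≤⟨ half-≤ k ⟩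
    m * 2              ≤⟨ *-monoˡ-≤ 2 m≤ ⟩
    length xs * 2      ≤⟨ ΔS-lower T S x y 2 unique inS (All.map dist-far far) ⟩
    ΔS T S x y         ∎
    where open ≤-Reasoning

  forks⇒resolves : ∀ {x y} {C D : V → Set} → Fork C → Fork D → (∀ {s} → C s → ¬ D s) →
    (∀ s → 1 ≤ ∣ d x s - d y s ∣) → k ≤ ΔS T S x y
  forks⇒resolves {x} {y} f g apart far =
    let xs , (unique , inS) , inC , m≤ = fork⇒chosen f
        ys , (unique′ , inS′) , inD , m≤′ = fork⇒chosen g
    in begin
    k                              ≤⟨ half-≤ k ⟩
    m * 2                          ≡⟨ trans (*-comm m 2) (cong (m +_) (+-identityʳ m)) ⟩
    m + m                          ≤⟨ +-mono-≤ m≤ m≤′ ⟩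
    length xs + length ys          ≡⟨ trans (*-identityʳ _) (length-++ xs) ⟨
    length (xs ++ ys) * 1          ≤⟨ ΔS-lower T S x y 1
                                        (Unique.++⁺ unique unique′ (λ { (x∈ , x∈′) → apart (All.lookup inC x∈) (All.lookup inD x∈′) }))
                                        (All.++⁺ inS inS′) (All.universal (dist-far ∘ far) (xs ++ ys)) ⟩
    ΔS T S x y                     ∎
    where open ≤-Reasoning

  -- S_k(T) resolves every pair of vertices

  module _ (¬S3 : ¬ IsS3 T) {r : V} (branch : 3 ≤ deg T r) where

    -- Two disjoint forks are needed. If a branch vertex lies beyond a neighbour u of r, there is
    -- one fork on each side of the edge ru, as r itself branches on the near side. Otherwise all
    -- components at r are threads; degree 3 is excluded, so four of them pair up.
    odd-resolves : ∀ {x y} → (∀ s → 1 ≤ ∣ d x s - d y s ∣) → k ≤ ΔS T S x y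
    odd-resolves {x} {y} far with Fin.any? (λ u → (adj T r u Bool.≟ true) ×-dec branchBeyond? r u)
    ... | yes (u , ru , bb) =
      forks⇒resolves (fork-beyond ru bb) (fork-beyond (~-sym ru) (r , beyond-self (~-sym ru) , branch)) beyond-asym far
    ... | no none = neighbours-rec r (λ _ → k ≤ ΔS T S x y) spider
      where
      low : ∀ {u} → r ~ u → ∀ s → Beyond r u s → deg T s ≤ 2
      low ru = no-branch λ bb → none (_ , ru , bb)
      deg≢3 : deg T r ≢ 3
      deg≢3 e = ¬S3 (r , e , λ v v≢r → let u , ru , b = toward (v≢r ∘ sym) in low ru v b)
      spider : ∀ ns → Unique ns → All (r ~_) ns → length ns ≡ deg T r → k ≤ ΔS T S x y
      spider (p ∷ q ∷ p′ ∷ q′ ∷ _)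
        ((p≢q ∷ p≢p′ ∷ p≢q′ ∷ _) ∷ (q≢p′ ∷ q≢q′ ∷ _) ∷ (p′≢q′ ∷ _) ∷ _) (rp ∷ rq ∷ rp′ ∷ rq′ ∷ _) _ =
        forks⇒resolves {C = λ s → Beyond r p s ⊎ Beyond r q s} {D = λ s → Beyond r p′ s ⊎ Beyond r q′ s}
          (fork-at branch rp rq p≢q (low rp) (low rq) inj₁ inj₂)
          (fork-at branch rp′ rq′ p′≢q′ (low rp′) (low rq′) inj₁ inj₂)
          (λ { (inj₁ b) (inj₁ b′) → p≢p′ (beyond-unique rp rp′ b b′)
             ; (inj₁ b) (inj₂ b′) → p≢q′ (beyond-unique rp rq′ b b′)
             ; (inj₂ b) (inj₁ b′) → q≢p′ (beyond-unique rq rp′ b b′)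
             ; (inj₂ b) (inj₂ b′) → q≢q′ (beyond-unique rq rq′ b b′) })
          far
      spider [] _ _ e = contradiction (subst (3 ≤_) (sym e) branch) λ ()
      spider (_ ∷ []) _ _ e = contradiction (subst (3 ≤_) (sym e) branch) λ { (s≤s ()) }
      spider (_ ∷ _ ∷ []) _ _ e = contradiction (subst (3 ≤_) (sym e) branch) λ { (s≤s (s≤s ())) }
      spider (_ ∷ _ ∷ _ ∷ []) _ _ e = contradiction (sym e) deg≢3

    -- x and y are at equal distance from w, beyond its distinct neighbours p and q.
    even-resolves : ∀ {x y w p q} → w ~ p → w ~ q → p ≢ q →
      (∀ {s} → Beyond w p s → 2 ≤ ∣ d x s - d y s ∣) →
      (∀ {s} → Beyond w q s → 2 ≤ ∣ d x s - d y s ∣) → k ≤ ΔS T S x y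
    even-resolves {x} {y} {w} {p} {q} wp wq p≢q far far′ with branchBeyond? w p | branchBeyond? w q | 3 ≤? deg T w
    ... | yes bb | _ | _ = fork⇒resolves (fork-map far (fork-beyond wp bb))
    ... | no _ | yes bb | _ = fork⇒resolves (fork-map far′ (fork-beyond wq bb))
    ... | no low | no low′ | yes deg≥3 =
      fork⇒resolves (fork-at deg≥3 wp wq p≢q (no-branch low) (no-branch low′) far far′)
    ... | no low | no low′ | no deg<3 = ⊥-elim outside
      where
      deg≤2 : deg T w ≤ 2
      deg≤2 = ≤-pred (≰⇒> deg<3)
      -- The branch vertex r is not w, whose degree is at most 2, so it lies beyond p or q; the
      -- first two cases have excluded that.
      outside : ⊥
      outside with toward {w} {r} (λ { refl → deg<3 branch })
      ... | u , wu , b with third-neighbour deg≤2 wp wq wu p≢q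
      ...   | inj₁ refl = low (r , b , branch)
      ...   | inj₂ refl = low′ (r , b , branch)

    resolves : WeakResolving T k S
    resolves x y x≢y = by-parity (halve (d x y))
      where
      by-parity : (∃ λ h → d x y ≡ h + h ⊎ d x y ≡ h + suc h) → k ≤ ΔS T S x y
      by-parity (zero , inj₁ e) = contradiction (d-zero e) x≢y
      by-parity (suc h , inj₁ e) =
        let w , xw , wy = between (suc h) (suc h) e
            p , pw , xp = d-pred xw
            q , qw , yq = d-pred (trans (d-sym y w) wy)
            x-beyond-p , _ , far = half-way pw xp wy e
            _ , x-beyond-w , far′ = half-way qw yq (trans (d-sym w x) xw) (trans (d-sym y x) e)
        in even-resolves (~-sym pw) (~-sym qw)
             -- x lies on the side of p for the edge wp, but on the side of w for the edge wq.
             (λ p≡q → beyond-asym x-beyond-p (subst (λ z → Beyond z w x) (sym p≡q) x-beyond-w))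
             far (λ {s} b → subst (2 ≤_) (∣-∣-comm (d y s) (d x s)) (far′ b))
      -- The middle edge is wp, with x at distance h from w and y at distance h from p. Every s lies
      -- on one of its sides and is strictly closer to the vertex on that side.
      by-parity (h , inj₂ e) =
        let w , xw , wy = between h (suc h) e
            p , pw , yp = d-pred (trans (d-sym y w) wy)
            y-beyond , x-beyond = geodesic-edge (~-sym pw) (trans e (sym (cong₂ (λ i j → i + suc j) xw (trans (d-sym p y) yp))))
        in odd-resolves (each w p (~-sym pw) y-beyond x-beyond (trans (d-sym w x) xw) (trans (d-sym p y) yp))
        where
        each : ∀ w p → w ~ p → Beyond w p y → Beyond p w x → d w x ≡ h → d p y ≡ h → ∀ s → 1 ≤ ∣ d x s - d y s ∣
        each w p wp yb xb wx py s with ~⇒±1 s wp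
        ... | inj₂ b = far-apart 1 wp yb b (≤-reflexive (cong suc (trans wx (sym py))))
        ... | inj₁ b = subst (1 ≤_) (∣-∣-comm (d y s) (d x s))
          (far-apart 1 (~-sym wp) xb b (≤-reflexive (cong suc (trans py (sym wx)))))

theorem4p1 : {n : ℕ} (T : Graph n) → IsTree T → ¬ IsPathGraph T → ¬ IsS3 T →
    (κ : ℕ) → IsKappa T κ → (k : ℕ) → 1 ≤ k → k ≤ κ →
    (R : List (Fin n)) → Unique R → (∀ v → (v ∈ R) ⇔ IsRoot T v) →
    (lab : Fin n → List (List (Fin n))) → (∀ v → v ∈ R → IsLabelling T v (lab v)) →
    IsWdim T k (ΣfkT k R lab) × WeakResolving T k (SkT k R lab) × ∣ SkT k R lab ∣ ≡ ΣfkT k R lab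
theorem4p1 T tree ¬path ¬S3 κ ((S₀ , S₀-resolves) , _) k 1≤k k≤κ R R-unique R-roots lab lab-ok =
  ((SkT k R lab , S-resolves , card) , λ S → lower-bound {S}) , S-resolves , card
  where
  -- A weak κ-resolving set is weak k-resolving for every k ≤ κ.
  open Labelled T tree k 1≤k (S₀ , λ x y x≢y → ≤-trans k≤κ (S₀-resolves x y x≢y)) R R-unique R-roots lab lab-ok
  S-resolves : WeakResolving T k (SkT k R lab)
  S-resolves with Fin.any? (λ v → 3 ≤? deg T v)
  ... | yes (_ , branch) = resolves ¬S3 branch
  ... | no none = contradiction (deg≤2⇒path T tree λ v → ≤-pred (≰⇒> λ branch → none (v , branch))) ¬path
  card : ∣ SkT k R lab ∣ ≡ ΣfkT k R lab
  -- The lower bound applied to S_k(T) itself supplies the missing inequality.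
  card = ≤-antisym upper-bound (lower-bound {SkT k R lab} S-resolves)
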